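{- For every integer $n\ge1$ there is $P$ such that for every prime power $p>P$, $\mathfrak L(p,n)$ is representable over a finite set of size $2p^2$.
   Context: For $3\le p<\omega$, $0\le n<\omega$, $\mathfrak L(p,n)$ is the finite symmetric integral relation algebra with atoms $1',a_0,\dots,a_p,t_1,\dots,t_n$ whose composition of atoms is given, for $0\le i,j\le p$, $i\ne j$, $1\le k,l\le n$, $k\ne l$, by: $a_i;a_i=1'+a_i$; $a_i;a_j=0'\cdot\overline{a_i+a_j}$ (where $0'=\overline{1'}$); $a_i;t_k=t_1+\cdots+t_n$; $t_k;t_k=1'+a_0+\cdots+a_p$; $t_k;t_l=a_0+\cdots+a_p$. A representation over a set $D$ is an injective map into $\mathcal P(D\times D)$ sending $0,1,\overline{\phantom{x}},+,\cdot,1',\breve{\ },;$ to $\emptyset$, $D\times D$, complement, union, intersection, identity relation on $D$, converse and relational composition.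
   Formalization: The rule for a_i;a_j (i≠j) is taken as the sum of the a_m with m≠i,j, without the t_k; read literally with 0' the complement of 1' it would contain every t_k, conflicting with a_i;t_k=t_1+…+t_n, so that no representation could exist for n≥1. -}

module Defs where

open import Data.Bool.Base using (Bool; true; false; _∧_; _∨_; not; if_then_else_)
open import Data.Bool.ListAction using (any)
open import Data.Fin.Base using (Fin)
open import Data.Fin.Properties using (_≟_)
open import Data.List.Base using (List; _∷_; _++_; map; allFin)
open import Data.Nat.Base using (ℕ; suc; _^_; _≤_)
open import Data.Nat.Primality using (Prime)
open import Data.Product.Base using (Σ; ∃-syntax; _×_)
open import Function.Base using (flip; id)
open import Function.Bundles using (_↔_)
open import Function.Definitions using (Congruent; Injective)
open import Level using (0ℓ)
open import Relation.Binary.Core using (Rel; _⇔_)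
open import Relation.Binary.Construct.Always using (Always)
open import Relation.Binary.Construct.Composition using () renaming (_;_ to _⨾_)
open import Relation.Binary.Construct.Intersection using (_∩_)
open import Relation.Binary.Construct.Never using (Never)
open import Relation.Binary.Construct.Union using (_∪_)
open import Relation.Binary.PropositionalEquality.Core using (_≡_; _≗_)
open import Relation.Nullary.Decidable.Core using (does)
open import Relation.Nullary.Negation.Core using (¬_)

PrimePower : ℕ → Set
PrimePower m = ∃[ q ] ∃[ k ] (Prime q × 1 ≤ k × m ≡ q ^ k)

-- The signature of relation algebras. The axioms are not recorded: they play
-- no part in the notion of representation, and hold in any algebra having one.
record RawRelationAlgebra : Set₁ where
  infix  4 _≈_
  infixl 6 _+_
  infixl 7 _·_ _⊙_
  field
    Carrier : Set
    _≈_     : Rel Carrier 0ℓ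
    𝟘 𝟙     : Carrier
    ∁       : Carrier → Carrier
    _+_ _·_ : Carrier → Carrier → Carrier
    1′      : Carrier
    conv    : Carrier → Carrier
    _⊙_     : Carrier → Carrier → Carrier

-- Elements of 𝒫(D × D) are Set-valued relations up to logical equivalence.
-- A representation h has decidable values, even constructively: 𝟙 = x + ∁ x
-- in a Boolean algebra, so h x ∪ ¬ h x is all of D × D.
record Representation (𝔄 : RawRelationAlgebra) (D : Set) : Set₁ where
  open RawRelationAlgebra 𝔄
  field
    h         : Carrier → Rel D 0ℓ
    cong      : Congruent _≈_ _⇔_ h
    injective : Injective _≈_ _⇔_ h
    h-𝟘       : h 𝟘 ⇔ Never {ℓ = 0ℓ}
    h-𝟙       : h 𝟙 ⇔ Always {ℓ = 0ℓ}
    h-∁       : ∀ x → h (∁ x) ⇔ (λ d e → ¬ h x d e)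
    h-+       : ∀ x y → h (x + y) ⇔ (h x ∪ h y)
    h-·       : ∀ x y → h (x · y) ⇔ (h x ∩ h y)
    h-1′      : h 1′ ⇔ _≡_
    h-conv    : ∀ x → h (conv x) ⇔ flip (h x)
    h-⊙       : ∀ x y → h (x ⊙ y) ⇔ (h x ⨾ h y)

RepresentableOverSize : RawRelationAlgebra → ℕ → Set₁
RepresentableOverSize 𝔄 m = Σ Set λ D → (D ↔ Fin m) × Representation 𝔄 D

module Lyndon (p n : ℕ) where

  -- t is indexed from 0 here, so t₁, …, tₙ are the values of t on Fin n.
  data Atom : Set where
    e : Atom
    a : Fin (suc p) → Atom
    t : Fin n → Atom

  atoms : List Atom
  atoms = e ∷ map a (allFin (suc p)) ++ map t (allFin n)

  -- An element is the set of atoms below it.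
  Element : Set
  Element = Atom → Bool

  infixl 6 _⊔_
  infixl 7 _⊓_ _∙_ _⊙_

  ⊥ ⊤ : Element
  ⊥ _ = false
  ⊤ _ = true

  ∁ : Element → Element
  ∁ x c = not (x c)

  _⊔_ _⊓_ : Element → Element → Element
  (x ⊔ y) c = x c ∨ y c
  (x ⊓ y) c = x c ∧ y c

  ⟦_⟧ : Atom → Element
  ⟦ e   ⟧ e     = true
  ⟦ a i ⟧ (a j) = does (i ≟ j)
  ⟦ t k ⟧ (t l) = does (k ≟ l)
  ⟦ _   ⟧ _     = false

  -- a₀ + ⋯ + aₚ
  Σa : Element
  Σa (a _) = true
  Σa _     = false

  -- t₁ + ⋯ + tₙ
  Σt : Element
  Σt (t _) = true
  Σt _     = false

  -- For i ≠ j, aᵢ ; aⱼ = 0′ · ∁ (aᵢ + aⱼ) is read inside the Lyndon subalgebra,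
  -- whose unit is 1′ + a₀ + ⋯ + aₚ, so it is the sum of the aₘ with m ≠ i , j.
  -- With 0′ taken in the whole algebra, tₖ would lie below aᵢ ; aⱼ while aⱼ is
  -- not below aᵢ ; tₖ = t₁ + ⋯ + tₙ, which no symmetric relation algebra allows.
  _∙_ : Atom → Atom → Element
  e   ∙ y   = ⟦ y ⟧
  x   ∙ e   = ⟦ x ⟧
  a i ∙ a j = if does (i ≟ j) then ⟦ e ⟧ ⊔ ⟦ a i ⟧ else Σa ⊓ ∁ (⟦ a i ⟧ ⊔ ⟦ a j ⟧)
  a _ ∙ t _ = Σt
  t _ ∙ a _ = Σt
  t k ∙ t l = if does (k ≟ l) then ⟦ e ⟧ ⊔ Σa else Σa

  -- The completely additive extension of _∙_ from atoms to elements.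
  _⊙_ : Element → Element → Element
  (x ⊙ y) c = any (λ u → any (λ v → x u ∧ y v ∧ (u ∙ v) c) atoms) atoms

-- Converse is the identity because the algebra is symmetric.
𝔏 : ℕ → ℕ → RawRelationAlgebra
𝔏 p n = record
  { Carrier = Element
  ; _≈_     = _≗_
  ; 𝟘       = ⊥
  ; 𝟙       = ⊤
  ; ∁       = ∁
  ; _+_     = _⊔_
  ; _·_     = _⊓_
  ; 1′      = ⟦ e ⟧
  ; conv    = id
  ; _⊙_     = _⊙_
  }
  where open Lyndon p n

{-# OPTIONS --safe #-}

-- The base set is two copies of the affine plane over 𝔽_q: inside a copy, aᵢ relates distinct points on
-- a line of the i-th of the q + 1 directions, and pairs across the copies are coloured by t₁, …, tₙ.
-- The composition table then holds as soon as, on every line minus a point and for any two points y ≠ y′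
-- of the other copy, each pair of colours is attained by some z towards y and y′. A uniformly random
-- colouring fails one such requirement with probability at most (1 − 1/n²)^(q−1), and there are only
-- O(q⁷) of them, so for large q some colouring satisfies all.
--
-- For q = pᵏ the field is a quotient of 𝔽ₚ[x]/(x^q − x). There y^q = y for all y, so multiplying by
-- powers y^(q−1) shrinks any nonzero element to one, ε, whose annihilator is a maximal ideal. Starting
-- from e = ∏_{0<d<k} (x^(pᵈ) − x), which is nonzero because its degree is below q, makes e invertible in
-- the quotient, so x has k distinct conjugates, 1, x, …, x^(k−1) are independent over 𝔽ₚ, and the
-- quotient has at least q elements; it has at most q as they are all roots of Y^q − Y.
module Submission where

open import Defs
open import Algebra.Bundles using (CommutativeMonoid; CommutativeRing)
open import Data.Bool.Base using (Bool; true; false; not)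
open import Data.Empty using (⊥-elim)
open import Data.Fin.Base as Fin using (Fin; toℕ; fromℕ; inject₁)
import Data.Fin.Properties as Fin
open import Data.List.Base as List using (List; []; _∷_; _++_)
open import Data.Nat.Base as ℕ using (ℕ; zero; suc; _≤_; _<_; s≤s; z<s; NonZero)
open import Data.Nat.Combinatorics using (nCk≡n!/k![n-k]!; k![n∸k]!∣n!; nCn≡1)
open import Data.Nat.DivMod using (_%_; m/n*n≡m)
open import Data.Nat.Divisibility using (_∣_; divides)
open import Data.Nat.Primality using (Prime; euclidsLemma; prime⇒nonTrivial; prime⇒nonZero)
import Data.Nat.Properties as ℕ
open import Data.Product.Base using (∃; ∃-syntax; ∃₂; _×_; _,_; proj₁; proj₂)
open import Data.Product.Properties using (≡-dec)
open import Data.Sum.Base using (_⊎_; inj₁; inj₂; [_,_]′)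
open import Data.Vec.Base as Vec using (Vec; []; _∷_)
open import Function.Base using (_∘_; id)
open import Function.Bundles using (Equivalence; _↔_)
open import Level using (0ℓ; _⊔_)
open import Relation.Binary.Definitions using (tri<; tri≈; tri>)
open import Relation.Binary.PropositionalEquality as ≡ using (_≡_; _≢_; _≗_; module ≡-Reasoning)
open import Relation.Nullary.Decidable.Core using (Dec; yes; no)
open import Relation.Nullary.Negation.Core using (¬_; contradiction)

-- Only the products involving some tₖ constrain the colouring. The product aᵢ ; tₖ needs a point z
-- in direction i from x with a given colour towards y; tₖ ; tₗ needs a z with given colours towards
-- two points y and y′. `Rich` asks for both at once, so that one family of events covers the table.
-- The q - 1 candidates z on a punctured line use disjoint pairs of cells, so their failures are
-- independent; hence the exponent. Means are multiplied by the number of colourings and the whole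
-- estimate stays in ℕ. The obstacle in the field construction is that 𝔽ₚ[x]/(x^q - x) also has
-- proper subfields of 𝔽_q among its residue fields (x ↦ 0 gives 𝔽ₚ), and an arbitrary maximal ideal
-- may lead to one of them. The element e vanishes in exactly those residue fields where x coincides
-- with an earlier conjugate, so a maximal ideal avoiding e has the full residue field. Representing
-- the ideal as the annihilator of a single ε turns equality in the quotient into an equation in a
-- finite ring, so it stays decidable and no irreducible polynomial has to be found.

-- Binomial coefficients and the Frobenius map in characteristic p.

module PrimeDividesBinomial where
  open import Data.Nat.Base
  open import Data.Nat.Combinatorics using (_C_)
  open import Data.Nat.Divisibility
  open import Data.Nat.Properties
  open ≡

  prime>1 : ∀ {p} → Prime p → 1 < p
  prime>1 {p} pr = nonTrivial⇒n>1 p {{prime⇒nonTrivial pr}}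

  prime∤! : ∀ {p} → Prime p → ∀ k → k < p → ¬ p ∣ k !
  prime∤! pr zero    _   p∣1 = <⇒≢ (prime>1 pr) (sym (∣1⇒≡1 p∣1))
  prime∤! pr (suc k) k<p p∣  =
    [ (λ d → <⇒≱ k<p (∣⇒≤ d)) , prime∤! pr k (<-trans (n<1+n k) k<p) ]′ (euclidsLemma (suc k) (k !) pr p∣)

  -- The coefficient times `k ! * (p ∸ k) !` is `p !`, which `p` divides, while both factorials are
  -- products of numbers below `p`.
  prime∣choose : ∀ {p} → Prime p → ∀ k → 0 < k → k < p → p ∣ p C k
  prime∣choose {p@(suc p-1)} pr k 0<k k<p =
    [ id , (λ d → ⊥-elim ([ prime∤! pr k k<p , prime∤! pr (p ∸ k) (∸-monoʳ-< 0<k (<⇒≤ k<p)) ]′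
        (euclidsLemma (k !) ((p ∸ k) !) pr d))) ]′
    (euclidsLemma (p C k) (k ! * (p ∸ k) !) pr (subst (p ∣_) (sym eq) (m∣m*n (p-1 !))))
    where
    instance _ = k !* (p ∸ k) !≢0
    eq : (p C k) * (k ! * (p ∸ k) !) ≡ p !
    eq = trans (cong (_* (k ! * (p ∸ k) !)) (nCk≡n!/k![n-k]! (<⇒≤ k<p))) (m/n*n≡m (k![n∸k]!∣n! (<⇒≤ k<p)))

open PrimeDividesBinomial

module RingPowers {c ℓ} (R : CommutativeRing c ℓ) where
  open CommutativeRing R public
  open import Algebra.Properties.CommutativeSemiring.Exp commutativeSemiring public
  open import Algebra.Properties.Semiring.Mult semiring public
    using (×-homo-+; ×-assocˡ; ×-congʳ) renaming (_×_ to _·_)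
  open import Algebra.Properties.Ring ring public
    using (-‿distribʳ-*; +-cancelˡ; x∙y⁻¹≈ε⇒x≈y; +-inverseʳ-unique)
  open import Relation.Binary.Reasoning.Setoid setoid public

  ·-zero : ∀ n → n · 0# ≈ 0#
  ·-zero zero    = refl
  ·-zero (suc n) = trans (+-identityˡ _) (·-zero n)

  0^ : ∀ n .{{_ : NonZero n}} → 0# ^ n ≈ 0#
  0^ (suc n) = zeroˡ _

  HasCharacteristic : ℕ → Set (c ⊔ ℓ)
  HasCharacteristic p = ∀ y → p · y ≈ 0#

  PowerIdentity : ℕ → Set (c ⊔ ℓ)
  PowerIdentity q = ∀ y → y ^ q ≈ y

  DecidableEquality : Set (c ⊔ ℓ)
  DecidableEquality = ∀ y z → Dec (y ≈ z)

  ZeroOrInvertible : Set (c ⊔ ℓ)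
  ZeroOrInvertible = ∀ y → y ≈ 0# ⊎ ∃[ z ] (y * z ≈ 1#)

  1^ : ∀ n → 1# ^ n ≈ 1#
  1^ zero    = refl
  1^ (suc n) = trans (*-identityˡ _) (1^ n)

module Frobenius {c ℓ} (R : CommutativeRing c ℓ) {p} (pr : Prime p) (char : RingPowers.HasCharacteristic R p) where
  open RingPowers R
  open import Algebra.Properties.CommutativeMonoid.Sum +-commutativeMonoid
    using (sum; sum-cong-≋; sum-init-last; sum-replicate-zero)
  open import Algebra.Properties.CommutativeSemiring.Binomial commutativeSemiring using (theorem; binomialTerm)

  ∣⇒·≈0 : ∀ {n} x → p ∣ n → n · x ≈ 0#
  ∣⇒·≈0 x (divides m ≡.refl) = trans (sym (×-assocˡ x m p)) (trans (×-congʳ m (char x)) (·-zero m))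

  frobenius-+ : ∀ x y → (x + y) ^ p ≈ x ^ p + y ^ p
  frobenius-+ x y = go p ≡.refl
    where
    go : ∀ m → m ≡ p → (x + y) ^ m ≈ x ^ m + y ^ m
    go zero        ≡.refl = contradiction (prime>1 pr) λ ()
    -- As a successor, the exponent exposes the first and last terms of the binomial sum; all terms
    -- between carry a multiple of `p`.
    go m@(suc m-1) ≡.refl = begin
      (x + y) ^ m                                           ≈⟨ theorem m x y ⟩
      T Fin.zero + sum (T ∘ Fin.suc)                        ≈⟨ +-cong first (sum-init-last (T ∘ Fin.suc)) ⟩
      y ^ m + (sum (T ∘ Fin.suc ∘ inject₁) + T (Fin.suc (fromℕ m-1)))
        ≈⟨ +-congˡ (+-cong (trans (sum-cong-≋ middle) (sum-replicate-zero m-1)) last) ⟩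
      y ^ m + (0# + x ^ m)                                  ≈⟨ +-congˡ (+-identityˡ _) ⟩
      y ^ m + x ^ m                                         ≈⟨ +-comm _ _ ⟩
      x ^ m + y ^ m                                         ∎
      where
      T = binomialTerm x y m
      first : T Fin.zero ≈ y ^ m
      first = trans (+-identityʳ _) (*-identityˡ _)
      last : T (Fin.suc (fromℕ m-1)) ≈ x ^ m
      last rewrite Fin.toℕ-fromℕ m-1 | nCn≡1 m | ℕ.n∸n≡0 m-1 = trans (+-identityʳ _) (*-identityʳ _)
      middle : ∀ i → T (Fin.suc (inject₁ i)) ≈ 0#
      middle i = ∣⇒·≈0 _ (prime∣choose pr (toℕ (Fin.suc (inject₁ i))) z<s
        (s≤s (≡.subst (_< m-1) (≡.sym (Fin.toℕ-inject₁ i)) (Fin.toℕ<n i))))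

  frobeniusⁿ-+ : ∀ d x y → (x + y) ^ (p ℕ.^ d) ≈ x ^ (p ℕ.^ d) + y ^ (p ℕ.^ d)
  frobeniusⁿ-+ zero    x y = trans (*-identityʳ _) (sym (+-cong (*-identityʳ _) (*-identityʳ _)))
  frobeniusⁿ-+ (suc d) x y = begin
    (x + y) ^ (p ℕ.* p ℕ.^ d)                 ≈⟨ ^-assocʳ _ p (p ℕ.^ d) ⟨
    ((x + y) ^ p) ^ (p ℕ.^ d)                 ≈⟨ ^-congˡ (p ℕ.^ d) (frobenius-+ x y) ⟩
    (x ^ p + y ^ p) ^ (p ℕ.^ d)               ≈⟨ frobeniusⁿ-+ d _ _ ⟩
    (x ^ p) ^ (p ℕ.^ d) + (y ^ p) ^ (p ℕ.^ d) ≈⟨ +-cong (^-assocʳ _ p (p ℕ.^ d)) (^-assocʳ _ p (p ℕ.^ d)) ⟩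
    x ^ (p ℕ.* p ℕ.^ d) + y ^ (p ℕ.* p ℕ.^ d) ∎

  instance
    p-nonZero : NonZero p
    p-nonZero = prime⇒nonZero pr

  frobenius-0 : 0# ^ p ≈ 0#
  frobenius-0 = 0^ p

  -- Follows from additivity alone, so `p = 2` needs no separate treatment.
  frobenius-neg : ∀ x → (- x) ^ p ≈ - (x ^ p)
  frobenius-neg x = +-inverseʳ-unique (x ^ p) ((- x) ^ p) (begin
    x ^ p + (- x) ^ p ≈⟨ frobenius-+ x (- x) ⟨
    (x - x) ^ p       ≈⟨ ^-congˡ p (-‿inverseʳ x) ⟩
    0# ^ p            ≈⟨ frobenius-0 ⟩
    0#                ∎)

  -- Fermat's little theorem, by additivity of Frobenius. It shows that coefficients from the prime
  -- field are fixed by Frobenius.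
  fermat : ∀ n → (n · 1#) ^ p ≈ n · 1#
  fermat zero    = frobenius-0
  fermat (suc n) = trans (frobenius-+ 1# (n · 1#)) (+-cong (1^ p) (fermat n))

-- The finite ring 𝔽ₚ[x]/(x^q - x).

-- A list f stands for the element Σ_{m ∈ f} xᵐ of 𝔽ₚ[x]/(x^q − x) with q = 2 + q′.
-- Equality is tested against all functionals φ with φ (q + n) = φ (1 + n), modulo p;
-- the product is then a convolution, and the ring laws hold already for the lists.
module TruncatedPolynomials (p q′ : ℕ) .{{_ : NonZero p}} where
  open import Data.Nat.Base
  open import Data.Nat.Properties
  open import Data.Nat.DivMod
  open import Data.List.Membership.Propositional using (_∈_)
  open import Data.List.Membership.Propositional.Properties using (∈-cartesianProductWith⁺; ∈-upTo⁺)
  open import Data.List.Relation.Unary.Any using (here)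
  open ≡

  q : ℕ
  q = suc (suc q′)

  infix 4 _≡ₚ_ _≈_
  _≡ₚ_ : ℕ → ℕ → Set
  a ≡ₚ b = a % p ≡ b % p

  ≡ₚ-+ : ∀ {a b c d} → a ≡ₚ b → c ≡ₚ d → a + c ≡ₚ b + d
  ≡ₚ-+ {a} {b} {c} {d} u v =
    trans (%-distribˡ-+ a c p) (trans (cong₂ (λ s t → (s + t) % p) u v) (sym (%-distribˡ-+ b d p)))

  ≡ₚ-* : ∀ {a b} c → a ≡ₚ b → a * c ≡ₚ b * c
  ≡ₚ-* {a} {b} c u =
    trans (%-distribˡ-* a c p) (trans (cong (λ s → (s * (c % p)) % p) u) (sym (%-distribˡ-* b c p)))

  Valid : (ℕ → ℕ) → Set
  Valid φ = ∀ n → φ (q + n) ≡ φ (1 + n)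

  ⟪_⟫ : List ℕ → (ℕ → ℕ) → ℕ
  ⟪ []    ⟫ φ = 0
  ⟪ m ∷ f ⟫ φ = φ m + ⟪ f ⟫ φ

  _≈_ : List ℕ → List ℕ → Set
  f ≈ g = ∀ φ → Valid φ → ⟪ f ⟫ φ ≡ₚ ⟪ g ⟫ φ

  _⊛_ : List ℕ → List ℕ → List ℕ
  []      ⊛ g = []
  (m ∷ f) ⊛ g = List.map (m +_) g ++ f ⊛ g

  times : ℕ → List ℕ → List ℕ
  times zero    f = []
  times (suc n) f = f ++ times n f

  -- Since `p` copies of `f` vanish, `p − 1` copies are its negative, and lists without signs
  -- suffice.
  ⊖_ : List ℕ → List ℕ
  ⊖ f = times (pred p) f

  ⟪⟫-cong : ∀ f {φ ψ} → φ ≗ ψ → ⟪ f ⟫ φ ≡ ⟪ f ⟫ ψ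
  ⟪⟫-cong []      eq = refl
  ⟪⟫-cong (m ∷ f) eq = cong₂ _+_ (eq m) (⟪⟫-cong f eq)

  ⟪⟫-congₚ : ∀ f {φ ψ} → (∀ m → φ m ≡ₚ ψ m) → ⟪ f ⟫ φ ≡ₚ ⟪ f ⟫ ψ
  ⟪⟫-congₚ []      eq = refl
  ⟪⟫-congₚ (m ∷ f) {φ} {ψ} eq = ≡ₚ-+ {φ m} {ψ m} (eq m) (⟪⟫-congₚ f eq)

  ⟪⟫-++ : ∀ f g φ → ⟪ f ++ g ⟫ φ ≡ ⟪ f ⟫ φ + ⟪ g ⟫ φ
  ⟪⟫-++ []      g φ = refl
  ⟪⟫-++ (m ∷ f) g φ = trans (cong (φ m +_) (⟪⟫-++ f g φ)) (sym (+-assoc (φ m) _ _))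

  ⟪⟫-map : ∀ (h : ℕ → ℕ) g φ → ⟪ List.map h g ⟫ φ ≡ ⟪ g ⟫ (φ ∘ h)
  ⟪⟫-map h []      φ = refl
  ⟪⟫-map h (m ∷ g) φ = cong (φ (h m) +_) (⟪⟫-map h g φ)

  ⟪⟫-⊛ : ∀ f g φ → ⟪ f ⊛ g ⟫ φ ≡ ⟪ f ⟫ (λ m → ⟪ g ⟫ (λ l → φ (m + l)))
  ⟪⟫-⊛ []      g φ = refl
  ⟪⟫-⊛ (m ∷ f) g φ = trans (⟪⟫-++ (List.map (m +_) g) _ φ) (cong₂ _+_ (⟪⟫-map (m +_) g φ) (⟪⟫-⊛ f g φ))

  ⟪⟫-times : ∀ n f φ → ⟪ times n f ⟫ φ ≡ n * ⟪ f ⟫ φ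
  ⟪⟫-times zero    f φ = refl
  ⟪⟫-times (suc n) f φ = trans (⟪⟫-++ f _ φ) (cong (⟪ f ⟫ φ +_) (⟪⟫-times n f φ))

  ⟪⟫-+ : ∀ f φ ψ → ⟪ f ⟫ (λ m → φ m + ψ m) ≡ ⟪ f ⟫ φ + ⟪ f ⟫ ψ
  ⟪⟫-+ []      φ ψ = refl
  ⟪⟫-+ (m ∷ f) φ ψ = trans (cong (φ m + ψ m +_) (⟪⟫-+ f φ ψ)) (interchange (φ m) (ψ m) _ _)
    where open import Algebra.Properties.CommutativeSemigroup +-commutativeSemigroup using (interchange)

  ⟪⟫-0 : ∀ f → ⟪ f ⟫ (λ _ → 0) ≡ 0
  ⟪⟫-0 []      = refl
  ⟪⟫-0 (m ∷ f) = ⟪⟫-0 f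

  ⟪⟫-swap : ∀ f g (φ : ℕ → ℕ → ℕ) → ⟪ f ⟫ (λ m → ⟪ g ⟫ (φ m)) ≡ ⟪ g ⟫ (λ l → ⟪ f ⟫ (λ m → φ m l))
  ⟪⟫-swap []      g φ = sym (⟪⟫-0 g)
  ⟪⟫-swap (m ∷ f) g φ = trans (cong (⟪ g ⟫ (φ m) +_) (⟪⟫-swap f g φ)) (sym (⟪⟫-+ g (φ m) _))

  valid-shift : ∀ {φ} m → Valid φ → Valid (λ l → φ (m + l))
  valid-shift {φ} m v n = begin
    φ (m + (q + n)) ≡⟨ cong φ (x∙yz≈y∙xz m q n) ⟩
    φ (q + (m + n)) ≡⟨ v (m + n) ⟩
    φ (1 + (m + n)) ≡⟨ cong φ (+-suc m n) ⟨
    φ (m + (1 + n)) ∎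
    where
    open ≡-Reasoning
    open import Algebra.Properties.CommutativeSemigroup +-commutativeSemigroup using (x∙yz≈y∙xz)

  valid-convolution : ∀ {φ} g → Valid φ → Valid (λ m → ⟪ g ⟫ (λ l → φ (m + l)))
  valid-convolution {φ} g v n = ⟪⟫-cong g (λ l → trans (cong φ (+-assoc q n l)) (v (n + l)))

  ≡⇒≈ : ∀ {f g} → (∀ φ → ⟪ f ⟫ φ ≡ ⟪ g ⟫ φ) → f ≈ g
  ≡⇒≈ eq φ _ = cong (_% p) (eq φ)

  ++-cong : ∀ {f f′ g g′} → f ≈ f′ → g ≈ g′ → (f ++ g) ≈ (f′ ++ g′)
  ++-cong {f} {f′} {g} {g′} u v φ φv = subst₂ _≡ₚ_ (sym (⟪⟫-++ f g φ)) (sym (⟪⟫-++ f′ g′ φ))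
    (≡ₚ-+ {⟪ f ⟫ φ} {⟪ f′ ⟫ φ} (u φ φv) (v φ φv))

  -- One factor is replaced at a time: shifts of a valid functional and its convolution with `g′`
  -- are valid again, hence admissible as tests.
  ⊛-cong : ∀ {f f′ g g′} → f ≈ f′ → g ≈ g′ → (f ⊛ g) ≈ (f′ ⊛ g′)
  ⊛-cong {f} {f′} {g} {g′} u v φ φv = subst₂ _≡ₚ_ (sym (⟪⟫-⊛ f g φ)) (sym (⟪⟫-⊛ f′ g′ φ))
    (trans (⟪⟫-congₚ f (λ m → v _ (valid-shift {φ} m φv))) (u _ (valid-convolution {φ} g′ φv)))

  times-cong : ∀ n {f g} → f ≈ g → times n f ≈ times n g
  times-cong zero    u = λ _ _ → refl
  times-cong (suc n) {f} {g} u = ++-cong {f} {g} u (times-cong n {f} {g} u)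

  times-p : ∀ f → times p f ≈ []
  times-p f φ _ = begin
    ⟪ times p f ⟫ φ % p ≡⟨ cong (_% p) (trans (⟪⟫-times p f φ) (*-comm p _)) ⟩
    ⟪ f ⟫ φ * p % p     ≡⟨ m*n%n≡0 (⟪ f ⟫ φ) p ⟩
    0                   ≡⟨ m*n%n≡0 0 p ⟨
    0 % p               ∎
    where open ≡-Reasoning

  ⊛-assoc : ∀ f g h → ((f ⊛ g) ⊛ h) ≈ (f ⊛ (g ⊛ h))
  ⊛-assoc f g h = ≡⇒≈ {(f ⊛ g) ⊛ h} {f ⊛ (g ⊛ h)} λ φ → begin
    ⟪ (f ⊛ g) ⊛ h ⟫ φ                                              ≡⟨ ⟪⟫-⊛ (f ⊛ g) h φ ⟩
    ⟪ f ⊛ g ⟫ (λ u → ⟪ h ⟫ (λ k → φ (u + k)))                      ≡⟨ ⟪⟫-⊛ f g _ ⟩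
    ⟪ f ⟫ (λ m → ⟪ g ⟫ (λ l → ⟪ h ⟫ (λ k → φ (m + l + k))))
      ≡⟨ ⟪⟫-cong f (λ m → ⟪⟫-cong g λ l → ⟪⟫-cong h λ k → cong φ (+-assoc m l k)) ⟩
    ⟪ f ⟫ (λ m → ⟪ g ⟫ (λ l → ⟪ h ⟫ (λ k → φ (m + (l + k)))))      ≡⟨ ⟪⟫-cong f (λ m → ⟪⟫-⊛ g h _) ⟨
    ⟪ f ⟫ (λ m → ⟪ g ⊛ h ⟫ (λ v → φ (m + v)))                      ≡⟨ ⟪⟫-⊛ f (g ⊛ h) φ ⟨
    ⟪ f ⊛ (g ⊛ h) ⟫ φ                                              ∎
    where open ≡-Reasoning

  ⊛-comm : ∀ f g → (f ⊛ g) ≈ (g ⊛ f)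
  ⊛-comm f g = ≡⇒≈ {f ⊛ g} {g ⊛ f} λ φ → begin
    ⟪ f ⊛ g ⟫ φ                              ≡⟨ ⟪⟫-⊛ f g φ ⟩
    ⟪ f ⟫ (λ m → ⟪ g ⟫ (λ l → φ (m + l)))    ≡⟨ ⟪⟫-swap f g _ ⟩
    ⟪ g ⟫ (λ l → ⟪ f ⟫ (λ m → φ (m + l)))    ≡⟨ ⟪⟫-cong g (λ l → ⟪⟫-cong f λ m → cong φ (+-comm m l)) ⟩
    ⟪ g ⟫ (λ l → ⟪ f ⟫ (λ m → φ (l + m)))    ≡⟨ ⟪⟫-⊛ g f φ ⟨
    ⟪ g ⊛ f ⟫ φ                              ∎
    where open ≡-Reasoning

  ⊛-identityˡ : ∀ f → ((0 ∷ []) ⊛ f) ≈ f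
  ⊛-identityˡ f = ≡⇒≈ {(0 ∷ []) ⊛ f} {f} λ φ → trans (⟪⟫-⊛ (0 ∷ []) f φ) (+-identityʳ _)

  ⊛-distribʳ : ∀ f g h → ((g ++ h) ⊛ f) ≈ (g ⊛ f ++ h ⊛ f)
  ⊛-distribʳ f g h = ≡⇒≈ {(g ++ h) ⊛ f} {g ⊛ f ++ h ⊛ f} λ φ → trans (⟪⟫-⊛ (g ++ h) f φ) (trans (⟪⟫-++ g h _)
    (trans (sym (cong₂ _+_ (⟪⟫-⊛ g f φ) (⟪⟫-⊛ h f φ))) (sym (⟪⟫-++ (g ⊛ f) (h ⊛ f) φ))))

  ≈-trans : ∀ {f g h} → f ≈ g → g ≈ h → f ≈ h
  ≈-trans u v φ φv = trans (u φ φv) (v φ φv)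

  ++-comm : ∀ f g → (f ++ g) ≈ (g ++ f)
  ++-comm f g = ≡⇒≈ {f ++ g} {g ++ f} λ φ →
    trans (⟪⟫-++ f g φ) (trans (+-comm (⟪ f ⟫ φ) _) (sym (⟪⟫-++ g f φ)))

  ⊖-inverseʳ : ∀ f → (f ++ ⊖ f) ≈ []
  ⊖-inverseʳ f φ v = trans (cong (λ m → ⟪ times m f ⟫ φ % p) (suc-pred p)) (times-p f φ v)

  ring : CommutativeRing 0ℓ 0ℓ
  ring = record
    { Carrier = List ℕ ; _≈_ = _≈_ ; _+_ = _++_ ; _*_ = _⊛_ ; -_ = ⊖_ ; 0# = [] ; 1# = 0 ∷ []
    ; isCommutativeRing = record
      { isRing = record
        { +-isAbelianGroup = record
          { isGroup = record
            { isMonoid = record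
              { isSemigroup = record
                { isMagma = record
                  { isEquivalence = record
                    { refl = λ _ _ → refl
                    ; sym = λ u φ v → sym (u φ v)
                    ; trans = λ {f} {g} {h} → ≈-trans {f} {g} {h} }
                  ; ∙-cong = λ {f} {f′} {g} {g′} → ++-cong {f} {f′} {g} {g′} }
                ; assoc = λ f g h φ _ → cong (λ l → ⟪ l ⟫ φ % p) (++-assoc f g h) }
              ; identity = (λ _ _ _ → refl) , (λ f φ _ → cong (λ l → ⟪ l ⟫ φ % p) (++-identityʳ f)) }
            ; inverse = (λ f → ≈-trans {⊖ f ++ f} {f ++ ⊖ f} {[]} (++-comm (⊖ f) f) (⊖-inverseʳ f)) , ⊖-inverseʳ
            ; ⁻¹-cong = λ {f} {g} → times-cong (pred p) {f} {g} }
          ; comm = ++-comm }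
        ; *-cong = λ {f} {f′} {g} {g′} → ⊛-cong {f} {f′} {g} {g′}
        ; *-assoc = ⊛-assoc
        ; *-identity = ⊛-identityˡ , λ f → ≈-trans {f ⊛ (0 ∷ [])} {(0 ∷ []) ⊛ f} {f} (⊛-comm f (0 ∷ [])) (⊛-identityˡ f)
        ; distrib = (λ f g h → ≈-trans {f ⊛ (g ++ h)} {(g ++ h) ⊛ f} {f ⊛ g ++ f ⊛ h} (⊛-comm f (g ++ h))
                      (≈-trans {(g ++ h) ⊛ f} {g ⊛ f ++ h ⊛ f} {f ⊛ g ++ f ⊛ h} (⊛-distribʳ f g h)
                      (++-cong {g ⊛ f} {f ⊛ g} {h ⊛ f} {f ⊛ h} (⊛-comm g f) (⊛-comm h f)))) , ⊛-distribʳ }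
      ; *-comm = ⊛-comm } }
    where open import Data.List.Properties using (++-assoc; ++-identityʳ)

  -- reduce m is the exponent below q with x^(reduce m) = xᵐ.
  step : ℕ → ℕ
  step i with suc i ≟ q
  ... | yes _ = 1
  ... | no  _ = suc i

  reduce : ℕ → ℕ
  reduce zero    = 0
  reduce (suc m) = step (reduce m)

  step-small : ∀ {i} → suc i < q → step i ≡ suc i
  step-small {i} lt with suc i ≟ q
  ... | yes eq = contradiction eq (<⇒≢ lt)
  ... | no  _  = refl

  reduce-small : ∀ i → i < q → reduce i ≡ i
  reduce-small zero    _  = refl
  reduce-small (suc i) lt = trans (cong step (reduce-small i (<-trans (n<1+n i) lt))) (step-small lt)

  step-< : ∀ {i} → i < q → step i < q
  step-< {i} lt with suc i ≟ q
  ... | yes _ = s≤s (s≤s z≤n)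
  ... | no ne = ≤∧≢⇒< lt ne

  reduce-< : ∀ m → reduce m < q
  reduce-< zero    = s≤s z≤n
  reduce-< (suc m) = step-< (reduce-< m)

  reduce-valid : Valid reduce
  reduce-valid zero = trans (cong reduce (+-identityʳ q)) (trans (cong step (reduce-small (suc q′) ≤-refl)) top)
    where
    top : step (suc q′) ≡ step 0
    top with q ≟ q
    ... | no ne = contradiction refl ne
    ... | yes _ with 1 ≟ q
    ...   | no _ = refl
  reduce-valid (suc n) = cong step (trans (cong (step ∘ reduce) (+-suc q′ n)) (reduce-valid n))

  -- The induction on `m` covers all valid functionals at once, because its step passes to the
  -- shifted functional `φ ∘ suc`.
  valid-reduce : ∀ {φ} → Valid φ → ∀ m → φ (reduce m) ≡ φ m
  valid-reduce {φ} v zero    = refl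
  valid-reduce {φ} v (suc m) = trans (lemma (reduce m)) (valid-reduce {φ ∘ suc} (valid-shift {φ} 1 v) m)
    where
    lemma : ∀ i → φ (step i) ≡ φ (suc i)
    lemma i with suc i ≟ q
    ... | no _     = refl
    ... | yes refl = trans (sym (v 0)) (cong φ (+-identityʳ q))

  indicator : ∀ {A : Set} → Dec A → ℕ
  indicator (yes _) = 1
  indicator (no  _) = 0

  -- The functional reading off the coefficient of `x ^ c` after reduction; for `c < q` these are
  -- dual to the monomial basis.
  δ : ℕ → ℕ → ℕ
  δ c m = indicator (reduce m ≟ c)

  δ-valid : ∀ c → Valid (δ c)
  δ-valid c n = cong (λ j → indicator (j ≟ c)) (reduce-valid n)

  pick : ∀ n j (φ : ℕ → ℕ) → j < n → ⟪ List.downFrom n ⟫ (λ c → indicator (j ≟ c) * φ c) ≡ φ j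
  pick (suc n) j φ lt with j ≟ n
  ... | no ne    = pick n j φ (≤∧≢⇒< (s≤s⁻¹ lt) ne)
  ... | yes refl = trans (cong₂ _+_ (+-identityʳ (φ j)) (rest j ≤-refl)) (+-identityʳ (φ j))
    where
    rest : ∀ m → m ≤ j → ⟪ List.downFrom m ⟫ (λ c → indicator (j ≟ c) * φ c) ≡ 0
    rest zero    _ = refl
    rest (suc m) m<j with j ≟ m
    ... | yes refl = contradiction m<j (<-irrefl refl)
    ... | no  _    = rest m (<⇒≤ m<j)

  -- Every valid functional is the combination of the `δ c` with weights `φ c`. Hence `q`
  -- coefficient tests decide `_≈_`, although it quantifies over all functionals.
  expand : ∀ f φ → Valid φ → ⟪ f ⟫ φ ≡ ⟪ List.downFrom q ⟫ (λ c → ⟪ f ⟫ (δ c) * φ c)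
  expand []      φ v = sym (⟪⟫-0 (List.downFrom q))
  expand (m ∷ f) φ v = sym (begin
    ⟪ D ⟫ (λ c → (δ c m + ⟪ f ⟫ (δ c)) * φ c)              ≡⟨ ⟪⟫-cong D (λ c → *-distribʳ-+ (φ c) (δ c m) _) ⟩
    ⟪ D ⟫ (λ c → δ c m * φ c + ⟪ f ⟫ (δ c) * φ c)          ≡⟨ ⟪⟫-+ D (λ c → δ c m * φ c) (λ c → ⟪ f ⟫ (δ c) * φ c) ⟩
    ⟪ D ⟫ (λ c → δ c m * φ c) + ⟪ D ⟫ (λ c → ⟪ f ⟫ (δ c) * φ c)
      ≡⟨ cong₂ _+_ (trans (pick q (reduce m) φ (reduce-< m)) (valid-reduce {φ} v m)) (sym (expand f φ v)) ⟩
    φ m + ⟪ f ⟫ φ                                          ∎)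
    where
    open ≡-Reasoning
    D = List.downFrom q

  coefficients⇒≈ : ∀ f g → (∀ {c} → c < q → ⟪ f ⟫ (δ c) ≡ₚ ⟪ g ⟫ (δ c)) → f ≈ g
  coefficients⇒≈ f g eq φ v =
    subst₂ _≡ₚ_ (sym (expand f φ v)) (sym (expand g φ v)) (go q ≤-refl)
    where
    go : ∀ n → n ≤ q → ⟪ List.downFrom n ⟫ (λ c → ⟪ f ⟫ (δ c) * φ c) ≡ₚ ⟪ List.downFrom n ⟫ (λ c → ⟪ g ⟫ (δ c) * φ c)
    go zero    _  = refl
    go (suc n) lt = ≡ₚ-+ {⟪ f ⟫ (δ n) * φ n} {⟪ g ⟫ (δ n) * φ n}
      (≡ₚ-* {⟪ f ⟫ (δ n)} {⟪ g ⟫ (δ n)} (φ n) (eq lt)) (go n (<⇒≤ lt))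

  _≈?_ : ∀ f g → Dec (f ≈ g)
  f ≈? g with allUpTo? (λ c → ⟪ f ⟫ (δ c) % p ≟ ⟪ g ⟫ (δ c) % p) q
  ... | yes eq = yes (coefficients⇒≈ f g eq)
  ... | no ne  = no λ eq → ne λ {c} _ → eq (δ c) (δ-valid c)

  -- At `c = q` this finite list meets every class of the ring, so that a statement about all
  -- elements can be arranged by going through it.
  reduced : ℕ → List (List ℕ)
  reduced zero    = [] ∷ []
  reduced (suc c) = List.cartesianProductWith (λ i f → times i (c ∷ []) ++ f) (List.upTo p) (reduced c)

  normalForm : List ℕ → ℕ → List ℕ
  normalForm f zero    = []
  normalForm f (suc c) = times (⟪ f ⟫ (δ c) % p) (c ∷ []) ++ normalForm f c

  normalForm∈reduced : ∀ f c → normalForm f c ∈ reduced c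
  normalForm∈reduced f zero    = here refl
  normalForm∈reduced f (suc c) = ∈-cartesianProductWith⁺ (λ i f → times i (c ∷ []) ++ f)
    (∈-upTo⁺ (m%n<n (⟪ f ⟫ (δ c)) p)) (normalForm∈reduced f c)

  ≈-normalForm : ∀ f → f ≈ normalForm f q
  ≈-normalForm f φ v = trans (cong (_% p) (expand f φ v)) (go q)
    where
    go : ∀ n → ⟪ List.downFrom n ⟫ (λ c → ⟪ f ⟫ (δ c) * φ c) ≡ₚ ⟪ normalForm f n ⟫ φ
    go zero    = refl
    go (suc n) = trans (≡ₚ-+ {⟪ f ⟫ (δ n) * φ n} {b * φ n} (≡ₚ-* {⟪ f ⟫ (δ n)} {b} (φ n) (sym (m%n%n≡m%n _ p))) (go n))
      (cong (_% p) (sym (trans (⟪⟫-++ (times b (n ∷ [])) (normalForm f n) φ)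
        (cong (_+ ⟪ normalForm f n ⟫ φ) (trans (⟪⟫-times b (n ∷ []) φ) (cong (b *_) (+-identityʳ (φ n))))))))
      where b = ⟪ f ⟫ (δ n) % p

-- Passing to a residue field by enlarging an annihilator.

module AnnihilatorQuotient {c ℓ} (R : CommutativeRing c ℓ) (ε : CommutativeRing.Carrier R) where
  open CommutativeRing R
  open import Relation.Binary.Reasoning.Setoid setoid

  infix 4 _∼_
  _∼_ : Carrier → Carrier → Set ℓ
  a ∼ b = ε * a ≈ ε * b

  ≈⇒∼ : ∀ {a b} → a ≈ b → a ∼ b
  ≈⇒∼ = *-congˡ

  +-cong-∼ : ∀ {a a′ b b′} → a ∼ a′ → b ∼ b′ → a + b ∼ a′ + b′
  +-cong-∼ u v = trans (distribˡ ε _ _) (trans (+-cong u v) (sym (distribˡ ε _ _)))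

  *-cong-∼ : ∀ {a a′ b b′} → a ∼ a′ → b ∼ b′ → a * b ∼ a′ * b′
  *-cong-∼ {a} {a′} {b} {b′} u v = begin
    ε * (a * b)   ≈⟨ *-assoc _ _ _ ⟨
    ε * a * b     ≈⟨ *-congʳ u ⟩
    ε * a′ * b    ≈⟨ *-assoc _ _ _ ⟩
    ε * (a′ * b)  ≈⟨ *-congˡ (*-comm a′ b) ⟩
    ε * (b * a′)  ≈⟨ *-assoc _ _ _ ⟨
    ε * b * a′    ≈⟨ *-congʳ v ⟩
    ε * b′ * a′   ≈⟨ *-assoc _ _ _ ⟩
    ε * (b′ * a′) ≈⟨ *-congˡ (*-comm b′ a′) ⟩
    ε * (a′ * b′) ∎

  -‿cong-∼ : ∀ {a a′} → a ∼ a′ → - a ∼ - a′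
  -‿cong-∼ u = trans (sym (-‿distribʳ-* ε _)) (trans (-‿cong u) (-‿distribʳ-* ε _))
    where open import Algebra.Properties.Ring ring using (-‿distribʳ-*)

  quotient : CommutativeRing c ℓ
  quotient = record
    { Carrier = Carrier ; _≈_ = _∼_ ; _+_ = _+_ ; _*_ = _*_ ; -_ = -_ ; 0# = 0# ; 1# = 1#
    ; isCommutativeRing = record
      { isRing = record
        { +-isAbelianGroup = record
          { isGroup = record
            { isMonoid = record
              { isSemigroup = record
                { isMagma = record
                  { isEquivalence = record { refl = refl ; sym = sym ; trans = trans }
                  ; ∙-cong = +-cong-∼ }
                ; assoc = λ a b c → ≈⇒∼ (+-assoc a b c) }
              ; identity = (λ a → ≈⇒∼ (+-identityˡ a)) , (λ a → ≈⇒∼ (+-identityʳ a)) }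
            ; inverse = (λ a → ≈⇒∼ (-‿inverseˡ a)) , (λ a → ≈⇒∼ (-‿inverseʳ a))
            ; ⁻¹-cong = -‿cong-∼ }
          ; comm = λ a b → ≈⇒∼ (+-comm a b) }
        ; *-cong = *-cong-∼
        ; *-assoc = λ a b c → ≈⇒∼ (*-assoc a b c)
        ; *-identity = (λ a → ≈⇒∼ (*-identityˡ a)) , (λ a → ≈⇒∼ (*-identityʳ a))
        ; distrib = (λ a b c → ≈⇒∼ (distribˡ a b c)) , (λ a b c → ≈⇒∼ (distribʳ a b c)) }
      ; *-comm = λ a b → ≈⇒∼ (*-comm a b) } }

  -- The two sides are stuck on n with different raw structures, so they are not definitionally equal.
  quotient-· : ∀ n y → RingPowers._·_ quotient n y ≡ RingPowers._·_ R n y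
  quotient-· zero    y = ≡.refl
  quotient-· (suc n) y = ≡.cong (y +_) (quotient-· n y)

  quotient-^ : ∀ y n → RingPowers._^_ quotient y n ≡ RingPowers._^_ R y n
  quotient-^ y zero    = ≡.refl
  quotient-^ y (suc n) = ≡.cong (y *_) (quotient-^ y n)

-- If y^q = y throughout, then y^(q−1) is idempotent, so replacing ε by ε y^(q−1) whenever ε y ≠ 0
-- keeps ε nonzero and makes y a unit modulo Ann ε.
module Sieve {c ℓ} (R : CommutativeRing c ℓ) (q′ : ℕ)
  (pow : RingPowers.PowerIdentity R (suc (suc q′))) (_≈?_ : RingPowers.DecidableEquality R) where
  open RingPowers R
  open import Data.List.Relation.Unary.All as All using (All; []; _∷_)

  -- Modulo the annihilator of `ε`, the element `y` is zero or a unit with inverse `y ^ q′`.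
  Separates : Carrier → Carrier → Set ℓ
  Separates ε y = ε * y ≈ 0# ⊎ ε * y ^ suc q′ ≈ ε

  -- Elements already settled stay settled when `ε` is multiplied further, which lets the sieve run
  -- through a list.
  separates-* : ∀ {ε y} z → Separates ε y → Separates (ε * z) y
  separates-* {ε} {y} z (inj₁ u) = inj₁ (begin
    ε * z * y   ≈⟨ trans (*-assoc ε z y) (trans (*-congˡ (*-comm z y)) (sym (*-assoc ε y z))) ⟩
    ε * y * z   ≈⟨ *-congʳ u ⟩
    0# * z      ≈⟨ zeroˡ z ⟩
    0#          ∎)
  separates-* {ε} {y} z (inj₂ u) = inj₂ (begin
    ε * z * y ^ suc q′   ≈⟨ trans (*-assoc ε z _) (trans (*-congˡ (*-comm z _)) (sym (*-assoc ε _ z))) ⟩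
    ε * y ^ suc q′ * z   ≈⟨ *-congʳ u ⟩
    ε * z                ∎)

  separates-cong : ∀ {ε ε′ y} → ε ≈ ε′ → Separates ε y → Separates ε′ y
  separates-cong eq (inj₁ u) = inj₁ (trans (*-congʳ (sym eq)) u)
  separates-cong eq (inj₂ u) = inj₂ (trans (*-congʳ (sym eq)) (trans u eq))

  separates-y : ∀ {ε y y′} → y ≈ y′ → Separates ε y → Separates ε y′
  separates-y eq (inj₁ u) = inj₁ (trans (*-congˡ (sym eq)) u)
  separates-y eq (inj₂ u) = inj₂ (trans (*-congˡ (^-congˡ (suc q′) (sym eq))) u)

  separates-power : ∀ ε y → Separates (ε * y ^ suc q′) y
  separates-power ε y = inj₂ (begin
    ε * (y * y ^ q′) * (y * y ^ q′)    ≈⟨ *-assoc _ _ _ ⟩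
    ε * ((y * y ^ q′) * (y * y ^ q′))  ≈⟨ *-congˡ (*-assoc _ _ _) ⟩
    ε * (y * (y ^ q′ * (y * y ^ q′)))  ≈⟨ *-congˡ (*-congˡ (*-comm _ _)) ⟩
    ε * (y * ((y * y ^ q′) * y ^ q′))  ≈⟨ *-congˡ (*-assoc _ _ _) ⟨
    ε * ((y * (y * y ^ q′)) * y ^ q′)  ≈⟨ *-congˡ (*-congʳ (pow y)) ⟩
    ε * (y * y ^ q′)                   ∎)

  power-nonzero : ∀ ε y → ε * y ^ suc q′ ≈ 0# → ε * y ≈ 0#
  power-nonzero ε y u = begin
    ε * y                  ≈⟨ *-congˡ (pow y) ⟨
    ε * (y * y ^ suc q′)   ≈⟨ *-congˡ (*-comm _ _) ⟩
    ε * (y ^ suc q′ * y)   ≈⟨ *-assoc _ _ _ ⟨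
    ε * y ^ suc q′ * y     ≈⟨ *-congʳ u ⟩
    0# * y                 ≈⟨ zeroˡ y ⟩
    0#                     ∎

  -- The result is returned as a multiple of the starting element; this is what later keeps that
  -- element from vanishing in the quotient.
  sieve : ∀ ε → ¬ ε ≈ 0# → ∀ ys → ∃[ w ] (¬ ε * w ≈ 0# × All (Separates (ε * w)) ys)
  sieve ε ε≉0 [] = 1# , (λ u → ε≉0 (trans (sym (*-identityʳ ε)) u)) , []
  sieve ε ε≉0 (y ∷ ys) with sieve ε ε≉0 ys
  ... | w , εw≉0 , sep with (ε * w * y) ≈? 0#
  ...   | yes u = w , εw≉0 , inj₁ u ∷ sep
  ...   | no ne = w * y ^ suc q′ , (λ u → ne (power-nonzero (ε * w) y (trans (*-assoc _ _ _) u)))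
    , separates-cong (*-assoc _ _ _) (separates-power (ε * w) y)
    ∷ All.map (λ s → separates-cong (*-assoc _ _ _) (separates-* (y ^ suc q′) s)) sep

-- The interface between construction and counting: `pow` bounds the number of elements from above,
-- `distinct` from below.
record GeneratedField (p k : ℕ) : Set₁ where
  field commutativeRing : CommutativeRing 0ℓ 0ℓ
  open RingPowers commutativeRing
  field
    _≈?_     : DecidableEquality
    char     : HasCharacteristic p
    1≉0      : ¬ 1# ≈ 0#
    pow      : PowerIdentity (p ℕ.^ k)
    invert   : ZeroOrInvertible
    x        : Carrier
    distinct : ∀ d → 0 < d → d < k → ¬ x ^ (p ℕ.^ d) ≈ x

-- A field generated by an element with k distinct conjugates.

module FieldConstruction {p} (pr : Prime p) (k q′ : ℕ) (p^k≡q : p ℕ.^ k ≡ suc (suc q′)) where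
  open import Data.Nat.Base using (pred; s≤s⁻¹; >-nonZero)
  open import Data.Nat.Properties using (_≟_; ≤-refl; ≤-reflexive; ≤-trans; <-trans; <-≤-trans; <⇒≤; <⇒≢; <⇒≤pred; ≤∧≢⇒<;
    +-mono-<-≤; +-monoʳ-<; *-monoˡ-≤; *-monoʳ-≤; m^n>0; suc-pred)
  open import Data.Nat.DivMod using (m<n⇒m%n≡m; m*n%n≡0)
  open import Data.List.Relation.Unary.All as All using (All; []; _∷_)
  import Data.List.Relation.Unary.All.Properties as All
  private instance
    p≢0 : NonZero p
    p≢0 = prime⇒nonZero pr

  open TruncatedPolynomials p q′ hiding (_≈_; ring; ≈-trans)
  S : CommutativeRing 0ℓ 0ℓ
  S = TruncatedPolynomials.ring p q′
  open RingPowers S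

  times≡· : ∀ n f → times n f ≡ n · f
  times≡· zero    f = ≡.refl
  times≡· (suc n) f = ≡.cong (f ++_) (times≡· n f)

  char-S : HasCharacteristic p
  char-S f = ≡.subst (_≈ 0#) (times≡· p f) (times-p f)

  open Frobenius S pr char-S hiding (p-nonZero)

  monomial-^ : ∀ m n → (m ∷ []) ^ n ≡ (n ℕ.* m ∷ [])
  monomial-^ m zero    = ≡.refl
  monomial-^ m (suc n) = ≡.cong ((m ∷ []) *_) (monomial-^ m n)

  valid-q* : ∀ φ → Valid φ → ∀ m → φ (m ℕ.* q) ≡ φ m
  valid-q* φ v zero    = ≡.refl
  valid-q* φ v (suc m) = ≡.trans (v (m ℕ.* q)) (valid-q* (φ ∘ suc) (valid-shift {φ} 1 v) m)

  monomial-pow : ∀ m → (m ∷ []) ^ (p ℕ.^ k) ≈ (m ∷ [])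
  monomial-pow m rewrite p^k≡q | monomial-^ m q | ℕ.*-comm q m =
    λ φ v → ≡.cong (λ a → (a ℕ.+ 0) % p) (valid-q* φ v m)

  -- The q-th power is an iterated Frobenius map, hence additive, so it suffices to check monomials,
  -- where x^q = x applies.
  pow-S : PowerIdentity (p ℕ.^ k)
  pow-S []      = ≡.subst (λ m → [] ^ m ≈ []) (≡.sym p^k≡q) (zeroˡ ([] ^ suc q′))
  pow-S (m ∷ f) = trans {(m ∷ f) ^ (p ℕ.^ k)} {(m ∷ []) ^ (p ℕ.^ k) + f ^ (p ℕ.^ k)} {m ∷ f}
    (frobeniusⁿ-+ k (m ∷ []) f)
    (+-cong {(m ∷ []) ^ (p ℕ.^ k)} {m ∷ []} {f ^ (p ℕ.^ k)} {f} (monomial-pow m) (pow-S f))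

  Monic : ℕ → List ℕ → Set
  Monic d f = ∃[ g ] (f ≡ d ∷ g × All (_< d) g)

  ⊛-degree : ∀ {d d′} g h → All (_< d) g → All (_≤ d′) h → All (_< d ℕ.+ d′) (g ⊛ h)
  ⊛-degree []      h []       v = []
  ⊛-degree (m ∷ g) h (lt ∷ u) v = All.++⁺ (All.map⁺ (All.map (+-mono-<-≤ lt) v)) (⊛-degree g h u v)

  monic-⊛ : ∀ {d d′ f f′} → Monic d f → Monic d′ f′ → Monic (d ℕ.+ d′) (f ⊛ f′)
  monic-⊛ {d} {d′} (g , ≡.refl , u) (g′ , ≡.refl , u′) = _ , ≡.refl ,
    All.++⁺ (All.map⁺ (All.map (+-monoʳ-< d) u′)) (⊛-degree g (d′ ∷ g′) u (≤-refl ∷ All.map <⇒≤ u′))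

  times-degree : ∀ {d m} n → m < d → All (_< d) (times n (m ∷ []))
  times-degree zero    lt = []
  times-degree (suc n) lt = lt ∷ times-degree n lt

  vanishes-below : ∀ {d} g → d < q → All (_< d) g → ⟪ g ⟫ (δ d) ≡ 0
  vanishes-below [] _ [] = ≡.refl
  vanishes-below {d} (m ∷ g) d<q (lt ∷ u) with reduce m ≟ d
  ... | yes eq = contradiction (≡.trans (≡.sym (reduce-small m (<-trans lt d<q))) eq) (<⇒≢ lt)
  ... | no  _  = vanishes-below g d<q u

  -- The functional `δ d` takes the value 1, which is nonzero modulo `p`. Since `d < q`, reduction
  -- moves neither `d` nor the lower exponents.
  monic≉0 : ∀ {d f} → d < q → Monic d f → ¬ f ≈ 0#
  monic≉0 {d} d<q (g , ≡.refl , u) eq = contradiction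
    (≡.trans (≡.sym (m<n⇒m%n≡m (prime>1 pr))) (≡.trans (≡.cong (_% p) (≡.sym value)) (≡.trans (eq (δ d) (δ-valid d)) (m*n%n≡0 0 p))))
    λ ()
    where
    value : ⟪ d ∷ g ⟫ (δ d) ≡ 1
    value with reduce d ≟ d
    ... | yes _ = ≡.cong suc (vanishes-below g d<q u)
    ... | no ne = contradiction (reduce-small d d<q) ne

  X : List ℕ
  X = 1 ∷ []

  factor : ℕ → List ℕ
  factor d = (p ℕ.^ d ∷ []) - X

  conjugates : ℕ → List ℕ
  conjugates zero    = 1#
  conjugates (suc d) = factor (suc d) * conjugates d

  degree : ℕ → ℕ
  degree zero    = 0
  degree (suc d) = p ℕ.^ suc d ℕ.+ degree d

  -- The sum p + ⋯ + p^d stays below the next power because `2 ≤ p`. With `d = k − 1` this puts the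
  -- degree of `e` below `q`.
  degree-< : ∀ d → degree d < p ℕ.^ suc d
  degree-< zero    = ≤-trans (<⇒≤ (prime>1 pr)) (≤-reflexive (≡.sym (ℕ.*-identityʳ p)))
  degree-< (suc d) = <-≤-trans (+-monoʳ-< (p ℕ.^ suc d) (degree-< d))
    (≤-trans (≤-reflexive (≡.cong (p ℕ.^ suc d ℕ.+_) (≡.sym (ℕ.+-identityʳ _)))) (*-monoˡ-≤ (p ℕ.^ suc d) (prime>1 pr)))

  1<p^ : ∀ d → 1 < p ℕ.^ suc d
  1<p^ d = <-≤-trans (prime>1 pr) (≤-trans (≤-reflexive (≡.sym (ℕ.*-identityʳ p))) (*-monoʳ-≤ p (m^n>0 p d)))

  conjugates-monic : ∀ d → Monic (degree d) (conjugates d)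
  conjugates-monic zero    = [] , ≡.refl , []
  conjugates-monic (suc d) = monic-⊛ {p ℕ.^ suc d} {degree d} {factor (suc d)} {conjugates d}
    (_ , ≡.refl , times-degree (pred p) (1<p^ d)) (conjugates-monic d)

  module _ (ε : List ℕ) where
    open AnnihilatorQuotient S ε public using (_∼_; quotient; quotient-·; quotient-^)
    module F = RingPowers quotient

    factor∼0⇒ : ∀ d → X ^ (p ℕ.^ d) ∼ X → factor d ∼ 0#
    factor∼0⇒ d u = F.trans {factor d} {X - X} {0#}
      (F.+-cong {p ℕ.^ d ∷ []} {X} { - X} { - X}
        (≡.subst (_∼ X) (≡.trans (monomial-^ 1 (p ℕ.^ d)) (≡.cong (_∷ []) (ℕ.*-identityʳ _))) u) (F.refl { - X}))
      (F.-‿inverseʳ X)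

    -- If x meets its d-th conjugate, the factor x^(p^d) - x of the product vanishes.
    conjugates∼0 : ∀ d n → 0 < d → d ≤ n → X ^ (p ℕ.^ d) ∼ X → conjugates n ∼ 0#
    conjugates∼0 (suc d) zero    _ () _
    conjugates∼0 d (suc n) 0<d d≤n u with d ≟ suc n
    ... | yes ≡.refl = F.trans {conjugates (suc n)} {0# * conjugates n} {0#}
        (F.*-congʳ {conjugates n} {factor d} {0#} (factor∼0⇒ d u)) (F.zeroˡ (conjugates n))
    ... | no ne      = F.trans {conjugates (suc n)} {factor (suc n) * 0#} {0#}
        (F.*-congˡ {factor (suc n)} {conjugates n} {0#} (conjugates∼0 d n 0<d (s≤s⁻¹ (≤∧≢⇒< d≤n ne)) u)) (F.zeroʳ (factor (suc n)))

  e : List ℕ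
  e = conjugates (pred k)

  e≉0 : 0 < k → ¬ e ≈ 0#
  e≉0 0<k = monic≉0 {degree (pred k)} {e}
    (≤-trans (degree-< (pred k)) (≤-reflexive (≡.trans (≡.cong (p ℕ.^_) (suc-pred k {{>-nonZero 0<k}})) p^k≡q)))
    (conjugates-monic (pred k))

  pow-q : PowerIdentity q
  pow-q f = ≡.subst (λ m → f ^ m ≈ f) p^k≡q (pow-S f)

  open Sieve S q′ pow-q _≈?_

  generatedField : 0 < k → GeneratedField p k
  generatedField 0<k with sieve e (e≉0 0<k) (reduced q)
  ... | w , ε≉0 , sep = record
    { commutativeRing = quotient ε
    ; _≈?_     = λ y z → (ε * y) ≈? (ε * z)
    ; char     = λ y → ≡.subst (λ z → ε * z ≈ ε * 0#) (≡.sym (quotient-· ε p y)) (*-congˡ {ε} {p · y} {0#} (char-S y))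
    ; 1≉0      = λ u → ε≉0 (trans {ε} {ε * 1#} {0#}
                   (sym {ε * 1#} {ε} (*-identityʳ ε)) (trans {ε * 1#} {ε * 0#} {0#} u (zeroʳ ε)))
    ; pow      = λ y → ≡.subst (λ z → ε * z ≈ ε * y) (≡.sym (quotient-^ ε y (p ℕ.^ k)))
                   (*-congˡ {ε} {y ^ (p ℕ.^ k)} {y} (pow-S y))
    ; invert   = λ y → [ (λ u → inj₁ (trans {ε * y} {0#} {ε * 0#} u (sym {ε * 0#} {0#} (zeroʳ ε))))
                       , (λ u → inj₂ (y ^ q′ , trans {ε * y ^ suc q′} {ε} {ε * 1#} u (sym {ε * 1#} {ε} (*-identityʳ ε)))) ]′ (separated y)
    ; x        = X
    ; distinct = λ d 0<d d<k u → e∼0⇒⊥ (conjugates∼0 ε d (pred k) 0<d (<⇒≤pred d<k)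
                   (≡.subst (λ z → ε * z ≈ ε * X) (quotient-^ ε X (p ℕ.^ d)) u))
    }
    where
    ε : List ℕ
    ε = e * w

    -- Separation depends only on the class of `y`, and every class has its normal form in the
    -- sieved list.
    separated : ∀ y → Separates ε y
    separated y = separates-y {ε} {normalForm y q} {y} (sym {y} {normalForm y q} (≈-normalForm y))
      (All.lookup sep (normalForm∈reduced y q))

    -- From `e ≈ e ^ q` the element `ε`, which is `e * w`, equals `ε * e * e ^ q′`; so `ε * e ≈ 0#`
    -- would make `ε` itself zero.
    e∼0⇒⊥ : ¬ ε * e ≈ ε * 0#
    e∼0⇒⊥ u = ε≉0 (begin
      e * w                  ≈⟨ *-congʳ {w} {e ^ q} {e} (pow-q e) ⟨
      e ^ q * w              ≈⟨ *-assoc e (e ^ suc q′) w ⟩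
      e * (e ^ suc q′ * w)   ≈⟨ *-congˡ {e} {e ^ suc q′ * w} {w * e ^ suc q′} (*-comm (e ^ suc q′) w) ⟩
      e * (w * e ^ suc q′)   ≈⟨ *-assoc e w (e ^ suc q′) ⟨
      ε * (e * e ^ q′)       ≈⟨ *-assoc ε e (e ^ q′) ⟨
      ε * e * e ^ q′         ≈⟨ *-congʳ {e ^ q′} {ε * e} {ε * 0#} u ⟩
      ε * 0# * e ^ q′        ≈⟨ *-congʳ {e ^ q′} {ε * 0#} {0#} (zeroʳ ε) ⟩
      0# * e ^ q′            ≈⟨ zeroˡ (e ^ q′) ⟩
      0#                     ∎)

-- Roots of polynomials and the exact size of the field.

module Invertibility {c ℓ} (R : CommutativeRing c ℓ) (invert : RingPowers.ZeroOrInvertible R) where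
  open RingPowers R

  cancel : ∀ a b → ¬ a ≈ 0# → a * b ≈ 0# → b ≈ 0#
  cancel a b a≉0 ab≈0 with invert a
  ... | inj₁ u = contradiction u a≉0
  ... | inj₂ (z , az≈1) = begin
    b           ≈⟨ *-identityˡ b ⟨
    1# * b      ≈⟨ *-congʳ (trans (*-comm z a) az≈1) ⟨
    z * a * b   ≈⟨ *-assoc z a b ⟩
    z * (a * b) ≈⟨ *-congˡ ab≈0 ⟩
    z * 0#      ≈⟨ zeroʳ z ⟩
    0#          ∎

module RootBound {c ℓ} (R : CommutativeRing c ℓ) (invert : RingPowers.ZeroOrInvertible R) where
  open RingPowers R
  open Invertibility R invert
  open import Data.Vec.Relation.Unary.All using (All; []; _∷_)

  eval : ∀ {m} → Vec Carrier m → Carrier → Carrier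
  eval []       y = 0#
  eval (c ∷ cs) y = c + y * eval cs y

  -- Synthetic division by Y - a: the coefficients of the quotient are the intermediate values of
  -- Horner's scheme at `a`.
  divide : ∀ {m} → Vec Carrier (suc m) → Carrier → Vec Carrier m
  divide {zero}  _        a = []
  divide {suc m} (c ∷ cs) a = eval cs a ∷ divide cs a

  eval-divide : ∀ {m} (cs : Vec Carrier (suc m)) a y → eval cs y ≈ (y - a) * eval (divide cs a) y + eval cs a
  eval-divide {zero} (c ∷ []) a y = begin
    c + y * 0#                          ≈⟨ +-congˡ (trans (zeroʳ y) (sym (zeroʳ a))) ⟩
    c + a * 0#                          ≈⟨ trans (+-congʳ (zeroʳ (y - a))) (+-identityˡ _) ⟨
    (y - a) * 0# + (c + a * 0#)         ∎
  eval-divide {suc m} (c ∷ cs) a y = begin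
    c + y * eval cs y                             ≈⟨ +-congˡ (*-congˡ (eval-divide cs a y)) ⟩
    c + y * ((y - a) * Q + e)                     ≈⟨ +-congˡ (distribˡ y _ _) ⟩
    c + (y * ((y - a) * Q) + y * e)               ≈⟨ +-congˡ (+-cong (xyz≈yxz y (y - a) Q) (*-congʳ split)) ⟩
    c + ((y - a) * (y * Q) + ((y - a) + a) * e)   ≈⟨ +-congˡ (+-congˡ (distribʳ e _ _)) ⟩
    c + ((y - a) * (y * Q) + ((y - a) * e + a * e)) ≈⟨ +-congˡ (+-assoc _ _ _) ⟨
    c + (((y - a) * (y * Q) + (y - a) * e) + a * e) ≈⟨ +-congˡ (+-congʳ (trans (+-comm _ _) (sym (distribˡ (y - a) _ _)))) ⟩
    c + ((y - a) * (e + y * Q) + a * e)           ≈⟨ x∙yz≈y∙xz c _ _ ⟩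
    (y - a) * (e + y * Q) + (c + a * e)           ∎
    where
    open import Algebra.Properties.CommutativeSemigroup (CommutativeMonoid.commutativeSemigroup +-commutativeMonoid) using (x∙yz≈y∙xz)
    open import Algebra.Properties.CommutativeSemigroup (CommutativeMonoid.commutativeSemigroup *-commutativeMonoid) using () renaming (x∙yz≈y∙xz to xyz≈yxz)
    Q = eval (divide cs a) y
    e = eval cs a
    split : y ≈ (y - a) + a
    split = sym (trans (+-assoc _ _ _) (trans (+-congˡ (-‿inverseˡ a)) (+-identityʳ y)))

  eval-zero : ∀ {m} {cs : Vec Carrier m} → All (_≈ 0#) cs → ∀ y → eval cs y ≈ 0#
  eval-zero []       y = refl
  eval-zero (u ∷ us) y = trans (+-cong u (trans (*-congˡ (eval-zero us y)) (zeroʳ y))) (+-identityˡ 0#)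

  constant-zero : ∀ {m} {c} {cs : Vec Carrier m} a → All (_≈ 0#) cs → eval (c ∷ cs) a ≈ 0# → All (_≈ 0#) (c ∷ cs)
  constant-zero {c = c} a us root =
    trans (sym (trans (+-congˡ (trans (*-congˡ (eval-zero us a)) (zeroʳ a))) (+-identityʳ c))) root ∷ us

  divide-zero : ∀ {m} (cs : Vec Carrier (suc m)) a → All (_≈ 0#) (divide cs a) → eval cs a ≈ 0# → All (_≈ 0#) cs
  divide-zero {zero}  (c ∷ []) a us       root = constant-zero a [] root
  -- The head of the quotient is the value of the tail at `a`, so `u` is the root condition for the
  -- recursive call.
  divide-zero {suc m} (c ∷ cs) a (u ∷ us) root = constant-zero a (divide-zero cs a us u) root

  -- Divide by Y - a for the first root a. At any other root the factor `b i - a` is nonzero and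
  -- cancels, leaving a root of the quotient.
  root-bound : ∀ {m} (cs : Vec Carrier m) (roots : Fin m → Carrier) → (∀ i j → roots i ≈ roots j → i ≡ j) →
               (∀ i → eval cs (roots i) ≈ 0#) → All (_≈ 0#) cs
  root-bound {zero}  []  roots inj zeros = []
  root-bound {suc m} cs  roots inj zeros = divide-zero cs a
    (root-bound (divide cs a) (roots ∘ Fin.suc) (λ i j eq → Fin.suc-injective (inj _ _ eq))
      (λ i → cancel (b i - a) _ (ne i) (begin
        (b i - a) * eval (divide cs a) (b i)              ≈⟨ +-identityʳ _ ⟨
        (b i - a) * eval (divide cs a) (b i) + 0#         ≈⟨ +-congˡ (zeros Fin.zero) ⟨
        (b i - a) * eval (divide cs a) (b i) + eval cs a  ≈⟨ eval-divide cs a (b i) ⟨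
        eval cs (b i)                                     ≈⟨ zeros (Fin.suc i) ⟩
        0#                                                ∎)))
    (zeros Fin.zero)
    where
    a = roots Fin.zero
    b = roots ∘ Fin.suc
    ne : ∀ i → ¬ b i - a ≈ 0#
    ne i u with () ← inj _ _ (x∙y⁻¹≈ε⇒x≈y _ _ u)

-- Equality in the field is a quotient relation. Numbering the elements by `Fin q` lets the points
-- of the plane have propositional, decidable equality.
record FiniteField (q : ℕ) : Set₁ where
  field commutativeRing : CommutativeRing 0ℓ 0ℓ
  open RingPowers commutativeRing
  field
    1≉0         : ¬ 1# ≈ 0#
    invert      : ZeroOrInvertible
    ι           : Fin q → Carrier
    κ           : Carrier → Fin q
    ι-injective : ∀ i j → ι i ≈ ι j → i ≡ j
    ι-κ         : ∀ y → ι (κ y) ≈ y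

module Cardinality {p} (pr : Prime p) (k q′ : ℕ) (p^k≡q : p ℕ.^ k ≡ suc (suc q′)) (G : GeneratedField p k) where
  open GeneratedField G
  open RingPowers commutativeRing
  open Frobenius commutativeRing pr char hiding (p-nonZero)
  open import Data.Vec.Relation.Unary.All as All using (All; []; _∷_)
  open import Data.Nat.Coprimality using (prime⇒coprime; coprime-Bézout)
  open import Data.Nat.GCD using (module Bézout)

  open RootBound commutativeRing invert

  -- Otherwise both `n` and `p` annihilate `1#`, and by Bézout so does their greatest common divisor
  -- 1.
  multiple≉0 : ∀ n .{{_ : NonZero n}} → n < p → ¬ n · 1# ≈ 0#
  multiple≉0 n n<p u with coprime-Bézout (prime⇒coprime pr n<p)
  ... | Bézout.+- a b eq = 1≉0 (begin
    1#                        ≈⟨ +-identityʳ 1# ⟨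
    1 · 1#                    ≈⟨ trans (+-congˡ multiple) (+-identityʳ _) ⟨
    1 · 1# + (b ℕ.* n) · 1#   ≈⟨ ×-homo-+ 1# 1 (b ℕ.* n) ⟨
    (1 ℕ.+ b ℕ.* n) · 1#      ≡⟨ ≡.cong (_· 1#) eq ⟩
    (a ℕ.* p) · 1#            ≈⟨ ∣⇒·≈0 1# (divides a ≡.refl) ⟩
    0#                        ∎)
    where
    multiple : (b ℕ.* n) · 1# ≈ 0#
    multiple = trans (sym (×-assocˡ 1# b n)) (trans (×-congʳ b u) (·-zero b))
  ... | Bézout.-+ a b eq = 1≉0 (begin
    1#                        ≈⟨ +-identityʳ 1# ⟨
    1 · 1#                    ≈⟨ trans (+-congˡ (∣⇒·≈0 1# (divides a ≡.refl))) (+-identityʳ _) ⟨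
    1 · 1# + (a ℕ.* p) · 1#   ≈⟨ ×-homo-+ 1# 1 (a ℕ.* p) ⟨
    (1 ℕ.+ a ℕ.* p) · 1#      ≡⟨ ≡.cong (_· 1#) eq ⟩
    (b ℕ.* n) · 1#            ≈⟨ trans (sym (×-assocˡ 1# b n)) (trans (×-congʳ b u) (·-zero b)) ⟩
    0#                        ∎)

  multiple-≤ : ∀ {i j} → i ≤ j → j < p → i · 1# ≈ j · 1# → i ≡ j
  multiple-≤ {i} {j} i≤j j<p eq with j ℕ.∸ i in d
  ... | zero  = ℕ.≤-antisym i≤j (ℕ.m∸n≡0⇒m≤n d)
  ... | suc e = contradiction (begin
    suc e · 1#        ≈⟨ +-cancelˡ (i · 1#) _ _ (begin
      i · 1# + suc e · 1#    ≈⟨ ×-homo-+ 1# i (suc e) ⟨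
      (i ℕ.+ suc e) · 1#     ≡⟨ ≡.cong (_· 1#) (≡.trans (≡.cong (i ℕ.+_) (≡.sym d)) (ℕ.m+[n∸m]≡n i≤j)) ⟩
      j · 1#                 ≈⟨ eq ⟨
      i · 1#                 ≈⟨ +-identityʳ _ ⟨
      i · 1# + 0#            ∎) ⟩
    0#                ∎) (multiple≉0 (suc e) (ℕ.≤-<-trans (ℕ.≤-trans (ℕ.≤-reflexive (≡.sym d)) (ℕ.m∸n≤m j i)) j<p))

  multiple-injective : ∀ {i j} → i < p → j < p → i · 1# ≈ j · 1# → i ≡ j
  multiple-injective {i} {j} i<p j<p eq with ℕ.≤-total i j
  ... | inj₁ i≤j = multiple-≤ i≤j j<p eq
  ... | inj₂ j≤i = ≡.sym (multiple-≤ j≤i i<p (sym eq))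

  power : ℕ → Carrier
  power d = x ^ (p ℕ.^ d)

  power-+ : ∀ i j → power i ^ (p ℕ.^ j) ≈ power (i ℕ.+ j)
  power-+ i j = trans (^-assocʳ x (p ℕ.^ i) (p ℕ.^ j)) (^-congʳ x (≡.sym (ℕ.^-distribˡ-+-* p i j)))

  power-k : ∀ d → power (k ℕ.+ d) ≈ power d
  power-k d = trans (sym (power-+ k d)) (^-congˡ (p ℕ.^ d) (pow x))

  -- Conjugation is cyclic of period `k`: raising an equality to the power `p ^ (k ∸ i)` moves
  -- `power i` to `x` and `power j` to `power (j ∸ i)`.
  power-distinct : ∀ {i j} → i < j → j < k → ¬ power i ≈ power j
  power-distinct {i} {j} i<j j<k eq = distinct (j ℕ.∸ i) (ℕ.m<n⇒0<n∸m i<j) (ℕ.≤-<-trans (ℕ.m∸n≤m j i) j<k) (begin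
    power (j ℕ.∸ i)                ≈⟨ power-k (j ℕ.∸ i) ⟨
    power (k ℕ.+ (j ℕ.∸ i))        ≡⟨ ≡.cong power (arith) ⟩
    power (j ℕ.+ (k ℕ.∸ i))        ≈⟨ power-+ j (k ℕ.∸ i) ⟨
    power j ^ (p ℕ.^ (k ℕ.∸ i))    ≈⟨ ^-congˡ (p ℕ.^ (k ℕ.∸ i)) eq ⟨
    power i ^ (p ℕ.^ (k ℕ.∸ i))    ≈⟨ power-+ i (k ℕ.∸ i) ⟩
    power (i ℕ.+ (k ℕ.∸ i))        ≡⟨ ≡.cong power (ℕ.m+[n∸m]≡n i≤k) ⟩
    power k                        ≈⟨ pow x ⟩
    x                              ∎)
    where
    i≤j = ℕ.<⇒≤ i<j
    i≤k = ℕ.<⇒≤ (ℕ.<-trans i<j j<k)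
    arith : k ℕ.+ (j ℕ.∸ i) ≡ j ℕ.+ (k ℕ.∸ i)
    arith = ≡.trans (≡.sym (ℕ.+-∸-assoc k i≤j)) (≡.trans (≡.cong (ℕ._∸ i) (ℕ.+-comm k j)) (ℕ.+-∸-assoc j i≤k))

  power-injective : ∀ (i j : Fin k) → power (toℕ i) ≈ power (toℕ j) → i ≡ j
  power-injective i j eq with ℕ.<-cmp (toℕ i) (toℕ j)
  ... | tri≈ _ i≡j _ = Fin.toℕ-injective i≡j
  ... | tri< i<j _ _ = contradiction eq (power-distinct i<j (Fin.toℕ<n j))
  ... | tri> _ _ j<i = contradiction (sym eq) (power-distinct j<i (Fin.toℕ<n i))

  Fixed : Carrier → Set
  Fixed c = c ^ p ≈ c

  eval-frobenius : ∀ {m} {cs : Vec Carrier m} → All Fixed cs → ∀ y → eval cs y ^ p ≈ eval cs (y ^ p)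
  eval-frobenius []                    y = frobenius-0
  eval-frobenius {cs = c ∷ cs} (u ∷ us) y = begin
    (c + y * eval cs y) ^ p         ≈⟨ frobenius-+ _ _ ⟩
    c ^ p + (y * eval cs y) ^ p     ≈⟨ +-cong u (^-distrib-* y _ p) ⟩
    c + y ^ p * eval cs y ^ p       ≈⟨ +-congˡ (*-congˡ (eval-frobenius us y)) ⟩
    c + y ^ p * eval cs (y ^ p)     ∎

  eval-cong : ∀ {m} (cs : Vec Carrier m) {y z} → y ≈ z → eval cs y ≈ eval cs z
  eval-cong []       eq = refl
  eval-cong (c ∷ cs) eq = +-congˡ (*-cong eq (eval-cong cs eq))

  -- Frobenius fixes the coefficients and therefore maps roots to roots; each conjugate is the p-th
  -- power of the one before.
  conjugate-roots : ∀ {m} {cs : Vec Carrier m} → All Fixed cs → eval cs x ≈ 0# → ∀ d → eval cs (power d) ≈ 0#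
  conjugate-roots {cs = cs} fixed root zero    = trans (eval-cong cs (*-identityʳ x)) root
  conjugate-roots {cs = cs} fixed root (suc d) = begin
    eval cs (power (suc d))    ≡⟨ ≡.cong (λ n → eval cs (x ^ n)) (ℕ.*-comm p (p ℕ.^ d)) ⟩
    eval cs (x ^ (p ℕ.^ d ℕ.* p))  ≈⟨ eval-cong cs (^-assocʳ x (p ℕ.^ d) p) ⟨
    eval cs (power d ^ p)      ≈⟨ eval-frobenius fixed (power d) ⟨
    eval cs (power d) ^ p      ≈⟨ ^-congˡ p (conjugate-roots fixed root d) ⟩
    0# ^ p                     ≈⟨ frobenius-0 ⟩
    0#                         ∎

  difference : ∀ {m} → (f g : Fin m → Fin p) → Vec Carrier m
  difference f g = Vec.tabulate λ i → toℕ (f i) · 1# - toℕ (g i) · 1#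

  fixed-difference : ∀ {m} (f g : Fin m → Fin p) → All Fixed (difference f g)
  fixed-difference {zero}  f g = []
  fixed-difference {suc m} f g =
    trans (frobenius-+ _ _) (+-cong (fermat (toℕ (f Fin.zero))) (trans (frobenius-neg _) (-‿cong (fermat (toℕ (g Fin.zero))))))
    ∷ fixed-difference (f ∘ Fin.suc) (g ∘ Fin.suc)

  combination : ∀ {m} → (Fin m → Fin p) → Carrier
  combination f = eval (Vec.tabulate λ i → toℕ (f i) · 1#) x

  eval-difference : ∀ {m} (f g : Fin m → Fin p) → eval (difference f g) x ≈ combination f - combination g
  eval-difference {zero}  f g = sym (-‿inverseʳ 0#)
  eval-difference {suc m} f g = begin
    (a - b) + x * eval (difference f′ g′) x   ≈⟨ +-congˡ (*-congˡ (eval-difference f′ g′)) ⟩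
    (a - b) + x * (A - B)                     ≈⟨ +-congˡ (x[y-z]≈xy-xz x A B) ⟩
    (a - b) + (x * A - x * B)                 ≈⟨ interchange a (- b) (x * A) (- (x * B)) ⟩
    (a + x * A) + (- b - x * B)               ≈⟨ +-congˡ (⁻¹-∙-comm b (x * B)) ⟩
    (a + x * A) - (b + x * B)                 ∎
    where
    open import Algebra.Properties.Ring ring using (x[y-z]≈xy-xz)
    open import Algebra.Properties.AbelianGroup +-abelianGroup using (⁻¹-∙-comm)
    open import Algebra.Properties.CommutativeSemigroup (CommutativeMonoid.commutativeSemigroup +-commutativeMonoid) using (interchange)
    f′ = f ∘ Fin.suc
    g′ = g ∘ Fin.suc
    a = toℕ (f Fin.zero) · 1#
    b = toℕ (g Fin.zero) · 1#
    A = combination f′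
    B = combination g′

  zero-difference : ∀ {m} (f g : Fin m → Fin p) → All (_≈ 0#) (difference f g) → f ≗ g
  zero-difference f g (u ∷ us) Fin.zero    = Fin.toℕ-injective
    (multiple-injective (Fin.toℕ<n (f Fin.zero)) (Fin.toℕ<n (g Fin.zero)) (x∙y⁻¹≈ε⇒x≈y _ _ u))
  zero-difference f g (u ∷ us) (Fin.suc i) = zero-difference (f ∘ Fin.suc) (g ∘ Fin.suc) us i

  -- A polynomial over 𝔽ₚ vanishing at x vanishes at its k distinct conjugates.
  combination-injective : ∀ (f g : Fin k → Fin p) → combination f ≈ combination g → f ≗ g
  combination-injective f g eq = zero-difference f g (root-bound (difference f g) (power ∘ toℕ) power-injective
    λ i → conjugate-roots (fixed-difference f g) (trans (eval-difference f g) (trans (+-congʳ eq) (-‿inverseʳ _))) (toℕ i))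

  funToFin-cong : ∀ {m n} {f g : Fin m → Fin n} → f ≗ g → Fin.funToFin f ≡ Fin.funToFin g
  funToFin-cong {zero}  eq = ≡.refl
  funToFin-cong {suc m} eq = ≡.cong₂ Fin.combine (eq Fin.zero) (funToFin-cong (eq ∘ Fin.suc))

  element : Fin (p ℕ.^ k) → Carrier
  element i = combination (Fin.finToFun {p} {k} i)

  element-injective : ∀ i j → element i ≈ element j → i ≡ j
  element-injective i j eq = ≡.trans (≡.sym (Fin.funToFin-finToFin {k} {p} i))
    (≡.trans (funToFin-cong (combination-injective _ _ eq)) (Fin.funToFin-finToFin {k} {p} j))

  monomial : ∀ m → Vec Carrier (suc m)
  monomial zero    = 1# ∷ []
  monomial (suc m) = 0# ∷ monomial m

  eval-monomial : ∀ m y → eval (monomial m) y ≈ y ^ m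
  eval-monomial zero    y = trans (+-congˡ (zeroʳ y)) (+-identityʳ 1#)
  eval-monomial (suc m) y = trans (+-identityˡ _) (*-congˡ (eval-monomial m y))

  monomial≉0 : ∀ m → ¬ All (_≈ 0#) (monomial m)
  monomial≉0 zero    (u ∷ _) = 1≉0 u
  monomial≉0 (suc m) (_ ∷ u) = monomial≉0 m u

  at-most-q : (roots : Fin (suc (p ℕ.^ k)) → Carrier) → ¬ (∀ i j → roots i ≈ roots j → i ≡ j)
  -- The vector holds the q + 1 coefficients of Y^q - Y, so q + 1 distinct roots would force its
  -- leading coefficient 1 to vanish.
  at-most-q rewrite p^k≡q = λ roots inj → case (root-bound (0# ∷ - 1# ∷ monomial q′) roots inj (λ i → vanish (roots i)))
    where
    case : ¬ All (_≈ 0#) (0# ∷ - 1# ∷ monomial q′)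
    case (_ ∷ _ ∷ u) = monomial≉0 q′ u
    vanish : ∀ y → eval (0# ∷ - 1# ∷ monomial q′) y ≈ 0#
    vanish y = begin
      0# + y * (- 1# + y * eval (monomial q′) y)   ≈⟨ +-identityˡ _ ⟩
      y * (- 1# + y * eval (monomial q′) y)        ≈⟨ *-congˡ (+-congˡ (*-congˡ (eval-monomial q′ y))) ⟩
      y * (- 1# + y * y ^ q′)                      ≈⟨ distribˡ y _ _ ⟩
      y * - 1# + y ^ suc (suc q′)                  ≈⟨ +-cong (trans (sym (-‿distribʳ-* y 1#)) (-‿cong (*-identityʳ y)))
                                                       (≡.subst (λ n → y ^ n ≈ y) p^k≡q (pow y)) ⟩
      - y + y                                      ≈⟨ -‿inverseˡ y ⟩
      0#                                           ∎

  -- Surjectivity by counting: an element missed by `element` would bring the number of distinct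
  -- elements to q + 1.
  index : ∀ y → ∃[ i ] (element i ≈ y)
  index y with Fin.any? (λ i → element i ≈? y)
  ... | yes found = found
  ... | no  none  = contradiction inj (at-most-q roots)
    where
    roots : Fin (suc (p ℕ.^ k)) → Carrier
    roots Fin.zero    = y
    roots (Fin.suc i) = element i
    inj : ∀ i j → roots i ≈ roots j → i ≡ j
    inj Fin.zero    Fin.zero    _  = ≡.refl
    inj Fin.zero    (Fin.suc j) eq = contradiction (j , sym eq) none
    inj (Fin.suc i) Fin.zero    eq = contradiction (i , eq) none
    inj (Fin.suc i) (Fin.suc j) eq = ≡.cong Fin.suc (element-injective i j eq)

  finiteField : FiniteField (p ℕ.^ k)
  finiteField = record
    { commutativeRing = commutativeRing ; 1≉0 = 1≉0 ; invert = invert ; ι = element ; κ = proj₁ ∘ index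
    ; ι-injective = element-injective ; ι-κ = proj₂ ∘ index }

-- Affine planes over a finite field.

Point : ℕ → Set
Point q = Fin q × Fin q

_≟ₚ_ : ∀ {q} (x y : Point q) → Dec (x ≡ y)
_≟ₚ_ = ≡-dec Fin._≟_ Fin._≟_

-- A line is given by a direction and a point on it, and is parametrised by `Fin q`; `position`
-- finds the parameter of the base point, so that this point can be removed.
record AffinePlane (q : ℕ) : Set₁ where
  field
    _∥[_]_       : Point q → Fin (suc q) → Point q → Set
    ∥-refl       : ∀ {i x} → x ∥[ i ] x
    ∥-sym        : ∀ {i x y} → x ∥[ i ] y → y ∥[ i ] x
    ∥-trans      : ∀ {i x y z} → x ∥[ i ] y → y ∥[ i ] z → x ∥[ i ] z
    direction    : ∀ {x y} → x ≢ y → ∃[ i ] (x ∥[ i ] y)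
    unique       : ∀ {x y i j} → x ≢ y → x ∥[ i ] y → x ∥[ j ] y → i ≡ j
    meet         : ∀ {i j} → i ≢ j → ∀ x y → ∃[ z ] (x ∥[ i ] z × z ∥[ j ] y)
    line         : Fin (suc q) → Point q → Fin q → Point q
    line-∥       : ∀ i x t → x ∥[ i ] line i x t
    line-inj     : ∀ i x {s t} → line i x s ≡ line i x t → s ≡ t
    position     : Fin (suc q) → Point q → Fin q
    line-through : ∀ i x → line i x (position i x) ≡ x

-- col s z y is the colour of the pair formed by z in copy s and y in the other copy of the plane.
Rich : ∀ {q n} → AffinePlane q → (Bool → Point q → Point q → Fin n) → Set
Rich A col = ∀ s i x {y y′} → y ≢ y′ → ∀ k l →
  ∃[ z ] (z ≢ x × x ∥[ i ] z × col s z y ≡ k × col s z y′ ≡ l)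
  where open AffinePlane A

module PunctureLines {q} (A : AffinePlane (suc q)) where
  open AffinePlane A
  open ≡ using (sym; trans)

  -- The order of the plane is `suc q` here, so a line without `x` has exactly `q` parameters.
  others : Fin (suc (suc q)) → Point (suc q) → Fin q → Point (suc q)
  others i x t = line i x (Fin.punchIn (position i x) t)

  others≢ : ∀ i x t → others i x t ≢ x
  others≢ i x t eq = Fin.punchInᵢ≢i (position i x) t (line-inj i x (trans eq (sym (line-through i x))))

  others-injective : ∀ i x {s t} → others i x s ≡ others i x t → s ≡ t
  others-injective i x eq = Fin.punchIn-injective (position i x) _ _ (line-inj i x eq)

-- Fin.zero is the vertical direction and Fin.suc m is slope m; a line is a level set of its coordinate.
module Coordinates {q} (K : FiniteField q) where
  open FiniteField K
  open RingPowers commutativeRing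
  open Invertibility commutativeRing invert
  open import Algebra.Properties.Ring (CommutativeRing.ring commutativeRing) using (x[y-z]≈xy-xz; [y-z]x≈yx-zx; +-cancelʳ)
  open import Algebra.Properties.AbelianGroup +-abelianGroup using (//-rightDividesˡ; //-rightDividesʳ; xyx⁻¹≈y)

  κ-ι : ∀ i → κ (ι i) ≡ i
  κ-ι i = ι-injective _ _ (ι-κ (ι i))

  κ-cong : ∀ {a b} → a ≈ b → κ a ≡ κ b
  κ-cong eq = ι-injective _ _ (trans (ι-κ _) (trans eq (sym (ι-κ _))))

  move : ∀ {a b c d} → a - b ≈ c - d → a + d ≈ c + b
  move {a} {b} {c} {d} eq = begin
    a + d             ≈⟨ +-congʳ (//-rightDividesˡ b a) ⟨
    a - b + b + d     ≈⟨ +-congʳ (+-congʳ eq) ⟩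
    c - d + b + d     ≈⟨ +-assoc _ _ _ ⟩
    c - d + (b + d)   ≈⟨ +-congˡ (+-comm b d) ⟩
    c - d + (d + b)   ≈⟨ +-assoc _ _ _ ⟨
    c - d + d + b     ≈⟨ +-congʳ (//-rightDividesˡ d c) ⟩
    c + b             ∎

  exchange : ∀ {a b c d} → a - b ≈ c - d → a - c ≈ b - d
  exchange {a} {b} {c} {d} eq = begin
    a - c             ≈⟨ +-congʳ (//-rightDividesʳ d a) ⟨
    a + d - d - c     ≈⟨ +-congʳ (+-congʳ (move eq)) ⟩
    c + b - d - c     ≈⟨ +-congʳ (+-assoc c b (- d)) ⟩
    c + (b - d) - c   ≈⟨ xyx⁻¹≈y c (b - d) ⟩
    b - d             ∎

  coordinate : Fin (suc q) → Point q → Carrier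
  coordinate Fin.zero    (u , v) = ι u
  coordinate (Fin.suc m) (u , v) = ι v - ι m * ι u

  Parallel : Point q → Fin (suc q) → Point q → Set
  Parallel x i y = coordinate i x ≈ coordinate i y

  slope : ∀ {x y} → x ≢ y → ∃[ i ] (Parallel x i y)
  slope {u , v} {u′ , v′} ne with u Fin.≟ u′
  ... | yes ≡.refl = Fin.zero , refl
  ... | no u≢u′ with invert (ι u - ι u′)
  ...   | inj₁ eq = contradiction (ι-injective _ _ (x∙y⁻¹≈ε⇒x≈y _ _ eq)) u≢u′
  ...   | inj₂ (z , inv) = Fin.suc (κ ((ι v - ι v′) * z)) , exchange (begin
      ι v - ι v′                            ≈⟨ *-identityʳ _ ⟨
      (ι v - ι v′) * 1#                     ≈⟨ *-congˡ (trans (*-comm z _) inv) ⟨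
      (ι v - ι v′) * (z * (ι u - ι u′))     ≈⟨ *-assoc _ _ _ ⟨
      (ι v - ι v′) * z * (ι u - ι u′)       ≈⟨ *-congʳ (ι-κ _) ⟨
      m * (ι u - ι u′)                      ≈⟨ x[y-z]≈xy-xz m _ _ ⟩
      m * ι u - m * ι u′                    ∎)
      where m = ι (κ ((ι v - ι v′) * z))

  vertical : ∀ {u v v′} m → Parallel (u , v) (Fin.suc m) (u , v′) → v ≡ v′
  vertical m eq = ι-injective _ _ (+-cancelʳ _ _ _ eq)

  slope-unique : ∀ {x y i j} → x ≢ y → Parallel x i y → Parallel x j y → i ≡ j
  slope-unique {i = Fin.zero}  {Fin.zero}  ne _ _ = ≡.refl
  slope-unique {i = Fin.zero}  {Fin.suc m} ne eq eq′ with ≡.refl ← ι-injective _ _ eq =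
    contradiction (≡.cong (_ ,_) (vertical m eq′)) ne
  slope-unique {i = Fin.suc m} {Fin.zero}  ne eq eq′ with ≡.refl ← ι-injective _ _ eq′ =
    contradiction (≡.cong (_ ,_) (vertical m eq)) ne
  slope-unique {u , v} {u′ , v′} {Fin.suc m} {Fin.suc m′} ne eq eq′ with u Fin.≟ u′
  ... | yes ≡.refl = contradiction (≡.cong (_ ,_) (vertical m eq)) ne
  ... | no u≢u′ = ≡.cong Fin.suc (ι-injective _ _ (x∙y⁻¹≈ε⇒x≈y _ _
      (cancel (ι u - ι u′) _ (u≢u′ ∘ ι-injective _ _ ∘ x∙y⁻¹≈ε⇒x≈y _ _) (begin
        (ι u - ι u′) * (ι m - ι m′)                      ≈⟨ x[y-z]≈xy-xz _ _ _ ⟩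
        (ι u - ι u′) * ι m - (ι u - ι u′) * ι m′         ≈⟨ +-cong (*-comm _ _) (-‿cong (*-comm _ _)) ⟩
        ι m * (ι u - ι u′) - ι m′ * (ι u - ι u′)         ≈⟨ +-congʳ (trans (rise m eq) (sym (rise m′ eq′))) ⟩
        ι m′ * (ι u - ι u′) - ι m′ * (ι u - ι u′)        ≈⟨ -‿inverseʳ _ ⟩
        0#                                               ∎))))
      where
      rise : ∀ m → Parallel (u , v) (Fin.suc m) (u′ , v′) → ι m * (ι u - ι u′) ≈ ι v - ι v′
      rise m eq = trans (x[y-z]≈xy-xz _ _ _) (sym (exchange eq))

  through : ∀ m c u → coordinate (Fin.suc m) (u , κ (c + ι m * ι u)) ≈ c
  through m c u = trans (+-congʳ (ι-κ _)) (//-rightDividesʳ _ c)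

  intersect : ∀ {i j} → i ≢ j → ∀ x y → ∃[ z ] (Parallel x i z × Parallel z j y)
  intersect {Fin.zero}  {Fin.zero}  ne _ _ = contradiction ≡.refl ne
  intersect {Fin.zero}  {Fin.suc m} ne (u , _) y = _ , refl , through m (coordinate (Fin.suc m) y) u
  intersect {Fin.suc m} {Fin.zero}  ne x (u , _) = _ , sym (through m (coordinate (Fin.suc m) x) u) , refl
  intersect {Fin.suc m} {Fin.suc m′} ne x y with invert (ι m′ - ι m)
  ... | inj₁ eq = contradiction (≡.cong Fin.suc (≡.sym (ι-injective _ _ (x∙y⁻¹≈ε⇒x≈y _ _ eq)))) ne
  ... | inj₂ (w , inv) = (u , κ (A + ι m * ι u)) , sym (through m A u) , (begin
      ι (κ (A + ι m * ι u)) - ι m′ * ι u   ≈⟨ +-congʳ (ι-κ _) ⟩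
      A + ι m * ι u - ι m′ * ι u           ≈⟨ +-congʳ (trans (move (sym difference)) (+-comm _ B)) ⟩
      B + ι m′ * ι u - ι m′ * ι u          ≈⟨ //-rightDividesʳ _ B ⟩
      B                                    ∎)
      where
      A = coordinate (Fin.suc m) x
      B = coordinate (Fin.suc m′) y
      -- The abscissa solving A + m u = B + m′ u, where `w` is the inverse of m′ - m.
      u = κ (w * (A - B))
      difference : ι m′ * ι u - ι m * ι u ≈ A - B
      difference = begin
        ι m′ * ι u - ι m * ι u           ≈⟨ [y-z]x≈yx-zx _ _ _ ⟨
        (ι m′ - ι m) * ι u               ≈⟨ *-congˡ (ι-κ _) ⟩
        (ι m′ - ι m) * (w * (A - B))     ≈⟨ *-assoc _ _ _ ⟨
        (ι m′ - ι m) * w * (A - B)       ≈⟨ *-congʳ inv ⟩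
        1# * (A - B)                     ≈⟨ *-identityˡ _ ⟩
        A - B                            ∎

  points : Fin (suc q) → Point q → Fin q → Point q
  points Fin.zero    (u , v) t = u , t
  points (Fin.suc m) x       t = t , κ (coordinate (Fin.suc m) x + ι m * ι t)

  parameter : Fin (suc q) → Point q → Fin q
  parameter Fin.zero    (u , v) = v
  parameter (Fin.suc m) (u , v) = u

  affinePlane : AffinePlane q
  affinePlane = record
    { _∥[_]_ = Parallel ; ∥-refl = refl ; ∥-sym = sym ; ∥-trans = trans
    ; direction = slope ; unique = slope-unique ; meet = intersect
    ; line = points
    ; line-∥ = λ { Fin.zero x t → refl ; (Fin.suc m) x t → sym (through m (coordinate (Fin.suc m) x) t) }
    ; line-inj = λ { Fin.zero x ≡.refl → ≡.refl ; (Fin.suc m) x eq → ≡.cong proj₁ eq }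
    ; position = parameter
    ; line-through = λ { Fin.zero x → ≡.refl
                       ; (Fin.suc m) (u , v) → ≡.cong (u ,_) (≡.trans (κ-cong (//-rightDividesˡ _ (ι v))) (κ-ι v)) }
    }

-- The probabilistic method with integer sums in place of probabilities.

-- Sums over all colourings of N cells with n colours; total F / n ^ N is the mean of F.
module Averages (n : ℕ) where
  open import Data.Nat.Base
  open import Data.Nat.Properties
  open import Algebra.Properties.CommutativeMonoid.Sum +-0-commutativeMonoid using (sum; sum-cong-≗; ∑-comm; ∑-distrib-+)
  open import Algebra.Properties.Semiring.Sum +-*-semiring using (*-distribˡ-sum; *-distribʳ-sum)
  open import Data.List.Relation.Unary.All as All using (All; []; _∷_)
  open import Data.List.Relation.Unary.AllPairs using (AllPairs; []; _∷_)
  open import Data.Vec.Properties using (lookup∘update; lookup∘update′)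
  open import Data.List.Relation.Unary.Any using (Any; here; there)
  open import Relation.Nullary.Decidable using (_×-dec_)
  open import Data.Vec.Base using (lookup; _[_]≔_)
  open ≡ using (refl; sym; trans; cong; cong₂)

  Colouring : ℕ → Set
  Colouring N = Vec (Fin n) N

  total : ∀ N → (Colouring N → ℕ) → ℕ
  total zero    F = F []
  total (suc N) F = sum λ a → total N (F ∘ (a ∷_))

  sum-mono : ∀ {m} {f g : Fin m → ℕ} → (∀ i → f i ≤ g i) → sum f ≤ sum g
  sum-mono {zero}  le = z≤n
  sum-mono {suc m} le = +-mono-≤ (le Fin.zero) (sum-mono (le ∘ Fin.suc))

  sum-const : ∀ m a → sum {m} (λ _ → a) ≡ m * a
  sum-const zero    a = refl
  sum-const (suc m) a = cong (a +_) (sum-const m a)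

  sum≡0 : ∀ {m} (f : Fin m → ℕ) → sum f ≡ 0 → ∀ i → f i ≡ 0
  sum≡0 f eq Fin.zero    = m+n≡0⇒m≡0 (f Fin.zero) eq
  sum≡0 f eq (Fin.suc i) = sum≡0 (f ∘ Fin.suc) (m+n≡0⇒n≡0 (f Fin.zero) eq) i

  sum-deficit : ∀ {m M} (f : Fin m → ℕ) k → (∀ i → f i ≤ M) → f k < M → sum f < m * M
  sum-deficit {suc m} {M} f Fin.zero    le lt = +-mono-<-≤ lt (≤-trans (sum-mono (le ∘ Fin.suc)) (≤-reflexive (sum-const m M)))
  sum-deficit {suc m} {M} f (Fin.suc k) le lt = +-mono-≤-< (le Fin.zero) (sum-deficit (f ∘ Fin.suc) k (le ∘ Fin.suc) lt)

  below-average : ∀ {m} M (f : Fin m → ℕ) → sum f < m * M → ∃[ i ] (f i < M)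
  below-average {suc m} M f lt with f Fin.zero <? M
  ... | yes f0<M = Fin.zero , f0<M
  ... | no  f0≮M with below-average M (f ∘ Fin.suc) (+-cancelˡ-< M _ _ (≤-<-trans (+-monoˡ-≤ _ (≮⇒≥ f0≮M)) lt))
  ...   | i , fi<M = Fin.suc i , fi<M

  total-cong : ∀ N {F G} → F ≗ G → total N F ≡ total N G
  total-cong zero    eq = eq []
  total-cong (suc N) eq = sum-cong-≗ λ a → total-cong N (eq ∘ (a ∷_))

  total-mono : ∀ N {F G} → (∀ c → F c ≤ G c) → total N F ≤ total N G
  total-mono zero    le = le []
  total-mono (suc N) le = sum-mono λ a → total-mono N (le ∘ (a ∷_))

  total-sum : ∀ N {m} (F : Fin m → Colouring N → ℕ) → total N (λ c → sum λ j → F j c) ≡ sum λ j → total N (F j)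
  total-sum zero    F = refl
  total-sum (suc N) F = trans (sum-cong-≗ λ a → total-sum N (λ j → F j ∘ (a ∷_))) (∑-comm λ a j → total N (F j ∘ (a ∷_)))

  total-+ : ∀ N F G → total N (λ c → F c + G c) ≡ total N F + total N G
  total-+ zero    F G = refl
  total-+ (suc N) F G = trans (sum-cong-≗ λ a → total-+ N (F ∘ (a ∷_)) (G ∘ (a ∷_)))
    (∑-distrib-+ (λ a → total N (F ∘ (a ∷_))) (λ a → total N (G ∘ (a ∷_))))

  total-* : ∀ N m F → total N (λ c → m * F c) ≡ m * total N F
  total-* zero    m F = refl
  total-* (suc N) m F = trans (sum-cong-≗ λ a → total-* N m (F ∘ (a ∷_))) (sym (*-distribˡ-sum m λ a → total N (F ∘ (a ∷_))))

  total-1 : ∀ N → total N (λ _ → 1) ≡ n ^ N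
  total-1 zero    = refl
  total-1 (suc N) = trans (sum-const n _) (cong (n *_) (total-1 N))

  total-0 : ∀ N → total N (λ _ → 0) ≡ 0
  total-0 N = total-* N 0 (λ _ → 0)

  -- Redrawing the colour of one cell leaves the mean unchanged; the factor `n` clears the
  -- denominator.
  resample : ∀ {N} i F → n * total N F ≡ total N (λ c → sum λ a → F (c [ i ]≔ a))
  resample {suc N} Fin.zero F = trans (cong (n *_) (sym (total-sum N λ a c → F (a ∷ c)))) (sym (sum-const n _))
  resample {suc N} (Fin.suc i) F = trans (*-distribˡ-sum n λ b → total N (F ∘ (b ∷_))) (sum-cong-≗ λ b → resample i (F ∘ (b ∷_)))

  -- A function into ℕ with mean below 1 has a zero. It is found cell by cell, choosing a colour
  -- that keeps the conditional mean below 1.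
  witness : ∀ N F → total N F < n ^ N → ∃[ c ] (F c ≡ 0)
  witness zero    F lt = [] , n<1⇒n≡0 lt
  witness (suc N) F lt with below-average (n ^ N) _ lt
  ... | a , lt′ with witness N (F ∘ (a ∷_)) lt′
  ...   | c , eq = a ∷ c , eq

  module _ {N : ℕ} (k l : Fin n) where
    Block : Set
    Block = Fin N × Fin N

    Hit : Colouring N → Block → Set
    Hit c (i , j) = lookup c i ≡ k × lookup c j ≡ l

    hit? : ∀ (a b : Fin n) → Dec (a ≡ k × b ≡ l)
    hit? a b = (a Fin.≟ k) ×-dec (b Fin.≟ l)

    missed : ∀ {A : Set} → Dec A → ℕ
    missed (yes _) = 0
    missed (no _)  = 1

    missed≤1 : ∀ {A : Set} (d : Dec A) → missed d ≤ 1
    missed≤1 (yes _) = z≤n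
    missed≤1 (no _)  = ≤-refl

    -- The indicator that no block shows the colours `k` and `l`, written as a product so that
    -- independent factors can be averaged separately.
    misses : List Block → Colouring N → ℕ
    misses []             c = 1
    misses ((i , j) ∷ bs) c = missed (hit? (lookup c i) (lookup c j)) * misses bs c

    misses≡0 : ∀ bs c → misses bs c ≡ 0 → Any (Hit c) bs
    misses≡0 ((i , j) ∷ bs) c eq with hit? (lookup c i) (lookup c j)
    ... | yes h = here h
    ... | no  _ = there (misses≡0 bs c (trans (sym (+-identityʳ _)) eq))

    Apart : Block → Block → Set
    Apart (i , j) (i′ , j′) = (i′ ≢ i × j′ ≢ i) × (i′ ≢ j × j′ ≢ j)

    misses-update : ∀ {i} bs c a → All (λ { (i′ , j′) → i′ ≢ i × j′ ≢ i }) bs → misses bs (c [ i ]≔ a) ≡ misses bs c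
    misses-update []        c a []             = refl
    misses-update (b ∷ bs)  c a ((u , v) ∷ us) = cong₂ _*_
      (cong₂ (λ s t → missed (hit? s t)) (lookup∘update′ u c a) (lookup∘update′ v c a)) (misses-update bs c a us)

    block-deficit : sum {n} (λ a → sum {n} λ b → missed (hit? a b)) < n * n
    block-deficit = sum-deficit _ k (λ a → ≤-trans (sum-mono λ b → missed≤1 (hit? a b)) (≤-reflexive n*1))
      (<-≤-trans (sum-deficit _ l (λ b → missed≤1 (hit? k b)) hit) (≤-reflexive (*-identityʳ n)))
      where
      n*1 : sum {n} (λ _ → 1) ≡ n
      n*1 = trans (sum-const n 1) (*-identityʳ n)
      hit : missed (hit? k l) < 1
      hit with hit? k l
      ... | yes _ = z<s
      ... | no ne = contradiction (refl , refl) ne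

    module _ {m} (n²≡ : n * n ≡ suc m) where
      -- Redraw both cells of the first block: the other factors do not see them, and at most `m` of
      -- the `suc m` colour pairs miss.
      misses-step : ∀ i j bs → i ≢ j → All (Apart (i , j)) bs →
                    suc m * total N (misses ((i , j) ∷ bs)) ≤ m * total N (misses bs)
      misses-step i j bs i≢j apart = begin
        suc m * total N F                                                ≡⟨ cong (_* total N F) n²≡ ⟨
        n * n * total N F                                                ≡⟨ *-assoc n n _ ⟩
        n * (n * total N F)                                              ≡⟨ cong (n *_) (resample j F) ⟩
        n * total N (λ c → sum λ b → F (c [ j ]≔ b))                     ≡⟨ resample i (λ c → sum λ b → F (c [ j ]≔ b)) ⟩
        total N (λ c → sum λ a → sum λ b → F (c [ i ]≔ a [ j ]≔ b))      ≡⟨ total-cong N collect ⟩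
        total N (λ c → sum (λ a → sum λ b → missed (hit? a b)) * misses bs c)
          ≤⟨ total-mono N (λ c → *-monoˡ-≤ (misses bs c) (s≤s⁻¹ (≤-trans block-deficit (≤-reflexive n²≡)))) ⟩
        total N (λ c → m * misses bs c)                                  ≡⟨ total-* N m (misses bs) ⟩
        m * total N (misses bs)                                          ∎
        where
        open ≤-Reasoning
        F = misses ((i , j) ∷ bs)
        factor : ∀ c a b → F (c [ i ]≔ a [ j ]≔ b) ≡ missed (hit? a b) * misses bs c
        factor c a b = cong₂ _*_
          (cong₂ (λ s t → missed (hit? s t)) (trans (lookup∘update′ i≢j (c [ i ]≔ a) b) (lookup∘update i c a)) (lookup∘update j (c [ i ]≔ a) b))
          (trans (misses-update bs (c [ i ]≔ a) b (All.map proj₂ apart)) (misses-update bs c a (All.map proj₁ apart)))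
        collect : ∀ c → sum (λ a → sum λ b → F (c [ i ]≔ a [ j ]≔ b)) ≡ sum (λ a → sum λ b → missed (hit? a b)) * misses bs c
        collect c = trans
          (sum-cong-≗ λ a → trans (sum-cong-≗ (factor c a)) (sym (*-distribʳ-sum (misses bs c) λ b → missed (hit? a b))))
          (sym (*-distribʳ-sum (misses bs c) λ a → sum λ b → missed (hit? a b)))

      misses-bound : ∀ bs → All (λ { (i , j) → i ≢ j }) bs → AllPairs Apart bs →
                     suc m ^ List.length bs * total N (misses bs) ≤ n ^ N * m ^ List.length bs
      misses-bound []             _          _          =
        ≤-reflexive (trans (+-identityʳ _) (trans (total-1 N) (sym (*-identityʳ _))))
      misses-bound ((i , j) ∷ bs) (ne ∷ nes) (ap ∷ aps) = begin
        suc m * suc m ^ s * T ((i , j) ∷ bs)     ≡⟨ [ab]c≡b[ac] (suc m) (suc m ^ s) _ ⟩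
        suc m ^ s * (suc m * T ((i , j) ∷ bs))   ≤⟨ *-monoʳ-≤ (suc m ^ s) (misses-step i j bs ne ap) ⟩
        suc m ^ s * (m * T bs)                   ≡⟨ a[bc]≡b[ac] (suc m ^ s) m (T bs) ⟩
        m * (suc m ^ s * T bs)                   ≤⟨ *-monoʳ-≤ m (misses-bound bs nes aps) ⟩
        m * (n ^ N * m ^ s)                      ≡⟨ a[bc]≡b[ac] m (n ^ N) (m ^ s) ⟩
        n ^ N * (m * m ^ s)                      ∎
        where
        open ≤-Reasoning
        s = List.length bs
        T = λ bs → total N (misses bs)
        a[bc]≡b[ac] : ∀ a b c → a * (b * c) ≡ b * (a * c)
        a[bc]≡b[ac] a b c = trans (sym (*-assoc a b c)) (trans (cong (_* c) (*-comm a b)) (*-assoc b a c))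
        [ab]c≡b[ac] : ∀ a b c → a * b * c ≡ b * (a * c)
        [ab]c≡b[ac] a b c = trans (cong (_* c) (*-comm a b)) (*-assoc b a c)

  -- Used with K = (m+1)^s, L = n^N m^s and m + 1 = n²: Bounded B F says that F has mean at most B (1 − 1/n²)^s.
  module UnionBound {N : ℕ} (K L : ℕ) where
    record Bounded (B : ℕ) (F : Colouring N → ℕ) : Set where
      constructor bounded
      field bound : K * total N F ≤ B * L

    bounded-0 : ∀ B → Bounded B (λ _ → 0)
    bounded-0 B = bounded (≤-trans (≤-reflexive (trans (cong (K *_) (total-0 N)) (*-zeroʳ K))) z≤n)

    bounded-+ : ∀ {A B F G} → Bounded A F → Bounded B G → Bounded (A + B) (λ c → F c + G c)
    bounded-+ {A} {B} {F} {G} (bounded u) (bounded v) = bounded (begin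
      K * total N (λ c → F c + G c)     ≡⟨ cong (K *_) (total-+ N F G) ⟩
      K * (total N F + total N G)       ≡⟨ *-distribˡ-+ K _ _ ⟩
      K * total N F + K * total N G     ≤⟨ +-mono-≤ u v ⟩
      A * L + B * L                     ≡⟨ *-distribʳ-+ L A B ⟨
      (A + B) * L                       ∎)
      where open ≤-Reasoning

    bounded-sum : ∀ {m B} {F : Fin m → Colouring N → ℕ} → (∀ j → Bounded B (F j)) → Bounded (m * B) (λ c → sum λ j → F j c)
    bounded-sum {zero}          u = bounded-0 0
    bounded-sum {suc m} {B} {F} u = bounded-+ (u Fin.zero) (bounded-sum (u ∘ Fin.suc))

    avoid : ∀ {B F} → Bounded B F → B * L < K * n ^ N → ∃[ c ] (F c ≡ 0)
    avoid {B} {F} (bounded u) lt = witness N F (*-cancelˡ-< K _ _ (≤-<-trans u lt))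

module RandomColouring {q} (A : AffinePlane (suc q)) (n : ℕ) .{{_ : NonZero n}} {m} (n²≡ : n ℕ.* n ≡ suc m) where
  open import Data.Nat.Base
  open import Data.Nat.Properties

  open import Data.List.Properties using (length-tabulate)
  import Data.List.Relation.Unary.All.Properties as All
  import Data.List.Relation.Unary.AllPairs.Properties as AllPairs
  import Data.List.Relation.Unary.Any.Properties as Any

  open import Algebra.Properties.CommutativeMonoid.Sum +-0-commutativeMonoid using (sum)
  open AffinePlane A
  open PunctureLines A
  open Averages n
  open ≡ using (refl; sym; trans; cong; cong₂)

  Pt : Set
  Pt = Point (suc q)



  N : ℕ
  N = (suc q * suc q) * (suc q * suc q)

  -- Both orientations of a pair across the copies share one cell, so any colouring of the cells is
  -- symmetric by definition.
  cell : Bool → Pt → Pt → Fin N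
  cell false (a , b) (c , d) = Fin.combine (Fin.combine a b) (Fin.combine c d)
  cell true  y       x       = cell false x y

  cell-injective : ∀ s {x y x′ y′} → cell s x y ≡ cell s x′ y′ → x ≡ x′ × y ≡ y′
  cell-injective false {a , b} {c , d} {a′ , b′} {c′ , d′} eq
    with u , v ← Fin.combine-injective (Fin.combine a b) (Fin.combine c d) (Fin.combine a′ b′) (Fin.combine c′ d′) eq
    with refl , refl ← Fin.combine-injective a b a′ b′ u | refl , refl ← Fin.combine-injective c d c′ d′ v = refl , refl
  cell-injective true eq with u , v ← cell-injective false eq = v , u

  blocks : Bool → Fin (suc (suc q)) → Pt → Pt → Pt → List (Fin N × Fin N)
  blocks s i x y y′ = List.tabulate λ t → cell s (others i x t) y , cell s (others i x t) y′

  open UnionBound {N} (suc m ^ q) (n ^ N * m ^ q)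

  fails : Bool → Fin (suc (suc q)) → Pt → Pt → Pt → Fin n → Fin n → Colouring N → ℕ
  fails s i x y y′ k l c with y ≟ₚ y′
  -- The sum over tests includes `y ≡ y′`, where richness demands nothing.
  ... | yes _ = 0
  ... | no  _ = misses k l (blocks s i x y y′) c

  -- `y ≢ y′` makes the two cells of a block distinct, and distinct points of the line make
  -- different blocks disjoint, so the `q` blocks are independent.
  fails-bounded : ∀ s i x y y′ k l → Bounded 1 (fails s i x y y′ k l)
  fails-bounded s i x y y′ k l with y ≟ₚ y′
  ... | yes _ = bounded-0 1
  ... | no ne = bounded (≤-trans (≡.subst (λ r → suc m ^ r * total N (misses k l bs) ≤ n ^ N * m ^ r) (length-tabulate block)
      (misses-bound k l n²≡ bs (All.tabulate⁺ λ t eq → ne (proj₂ (cell-injective s eq)))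
        (AllPairs.tabulate⁺ λ t≢t′ → (apart t≢t′ , apart t≢t′) , (apart t≢t′ , apart t≢t′))))
    (≤-reflexive (sym (+-identityʳ (n ^ N * m ^ q)))))
    where
    block = λ t → cell s (others i x t) y , cell s (others i x t) y′
    bs = blocks s i x y y′
    apart : ∀ {t t′ u u′} → t ≢ t′ → cell s (others i x t′) u ≢ cell s (others i x t) u′
    apart t≢t′ eq = t≢t′ (others-injective i x (sym (proj₁ (cell-injective s eq))))

  fails≡0 : ∀ s i x {y y′} k l c → y ≢ y′ → fails s i x y y′ k l c ≡ 0 →
            ∃[ z ] (z ≢ x × x ∥[ i ] z × Vec.lookup c (cell s z y) ≡ k × Vec.lookup c (cell s z y′) ≡ l)
  fails≡0 s i x {y} {y′} k l c ne eq with y ≟ₚ y′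
  ... | yes e = contradiction e ne
  ... | no  _ with Any.tabulate⁻ (misses≡0 k l (blocks s i x y y′) c eq)
  ...   | t , u , v = others i x t , others≢ i x t , line-∥ i x _ , u , v

  sumₚ : (Pt → ℕ) → ℕ
  sumₚ f = sum λ a → sum λ b → f (a , b)

  sumₚ≡0 : ∀ f → sumₚ f ≡ 0 → ∀ x → f x ≡ 0
  sumₚ≡0 f eq (a , b) = sum≡0 (λ b → f (a , b)) (sum≡0 (λ a → sum λ b → f (a , b)) eq a) b

  bounded-sumₚ : ∀ {B} {F : Pt → Colouring N → ℕ} → (∀ x → Bounded B (F x)) →
                 Bounded (suc q * (suc q * B)) (λ c → sumₚ λ x → F x c)
  bounded-sumₚ u = bounded-sum λ a → bounded-sum λ b → u (a , b)

  failure : Fin (suc (suc q)) → Pt → Pt → Pt → Fin n → Fin n → Colouring N → ℕ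
  failure i x y y′ k l c = fails false i x y y′ k l c + fails true i x y y′ k l c

  failures₃ : Pt → Pt → Pt → Colouring N → ℕ
  failures₃ x y y′ c = sum λ i → sum λ k → sum λ l → failure i x y y′ k l c

  failures : Colouring N → ℕ
  failures c = sumₚ λ x → sumₚ λ y → sumₚ λ y′ → failures₃ x y y′ c

  -- The number of tests: three points, a direction, two colours and a copy.
  bound : ℕ
  bound = let Q = λ B → suc q * (suc q * B) in Q (Q (Q (suc (suc q) * (n * (n * 2)))))

  failures-bounded : Bounded bound failures
  failures-bounded = bounded-sumₚ λ x → bounded-sumₚ λ y → bounded-sumₚ λ y′ →
    bounded-sum λ i → bounded-sum λ k → bounded-sum λ l →
    bounded-+ (fails-bounded false i x y y′ k l) (fails-bounded true i x y y′ k l)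

  colouring : bound * m ^ q < suc m ^ q → ∃[ c ] (failures c ≡ 0)
  colouring lt = avoid failures-bounded (begin-strict
    bound * (n ^ N * m ^ q)   ≡⟨ x∙yz≈y∙xz bound (n ^ N) (m ^ q) ⟩
    n ^ N * (bound * m ^ q)   <⟨ *-monoʳ-< (n ^ N) {{m^n≢0 n N}} lt ⟩
    n ^ N * suc m ^ q         ≡⟨ *-comm (n ^ N) _ ⟩
    suc m ^ q * n ^ N         ∎)
    where
    open ≤-Reasoning
    open import Algebra.Properties.CommutativeSemigroup *-commutativeSemigroup using (x∙yz≈y∙xz)



  module _ (c : Colouring N) (none : failures c ≡ 0) where
    zeros : ∀ x y y′ i k l → failure i x y y′ k l c ≡ 0
    zeros x y y′ i k l =
      sum≡0 (λ l → failure i x y y′ k l c)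
        (sum≡0 (λ k → sum λ l → failure i x y y′ k l c)
          (sum≡0 (λ i → sum λ k → sum λ l → failure i x y y′ k l c)
            (sumₚ≡0 (λ y′ → failures₃ x y y′ c)
              (sumₚ≡0 (λ y → sumₚ λ y′ → failures₃ x y y′ c)
                (sumₚ≡0 (λ x → sumₚ λ y → sumₚ λ y′ → failures₃ x y y′ c) none x) y) y′) i) k) l

    rich : Rich A λ s x y → Vec.lookup c (cell s x y)
    rich false i x {y} {y′} ne k l = fails≡0 false i x k l c ne
      (m+n≡0⇒m≡0 (fails false i x y y′ k l c) (zeros x y y′ i k l))
    rich true  i x {y} {y′} ne k l = fails≡0 true i x k l c ne
      (m+n≡0⇒n≡0 (fails false i x y y′ k l c) (zeros x y y′ i k l))

  rich-colouring : bound * m ^ q < suc m ^ q →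
    ∃[ col ] ((∀ x y → col true y x ≡ col false x y) × Rich A col)
  rich-colouring lt = let c , none = colouring lt in
    (λ s x y → Vec.lookup c (cell s x y)) , (λ x y → refl) , rich c none

-- An exponential eventually beats a polynomial, in integer form.

module Growth where
  open import Data.Nat.Base
  open import Data.Nat.Properties
  open import Data.Nat.DivMod using (_/_; m≡m%n+[m/n]*n; m%n<n; /-mono-≤; m*n/n≡m)
  open import Data.Nat.Solver using (module +-*-Solver)
  open +-*-Solver using (solve; _:+_; _:*_; _:=_; con)
  open ≤-Reasoning

  -- Bernoulli's inequality (1 + 1/m)^u ≥ 1 + u/m, cleared of denominators.
  bernoulli : ∀ m u → m ^ u * (m + u) ≤ m * suc m ^ u
  bernoulli m zero    = ≤-reflexive (solve 1 (λ m → con 1 :* (m :+ con 0) := m :* con 1) ≡.refl m)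
  bernoulli m (suc u) = begin
    m * m ^ u * (m + suc u)        ≡⟨ solve 3 (λ m u w → m :* w :* (m :+ (con 1 :+ u)) := w :* (m :* (m :+ (con 1 :+ u)))) ≡.refl m u (m ^ u) ⟩
    m ^ u * (m * (m + suc u))      ≤⟨ *-monoʳ-≤ (m ^ u) (m≤m+n _ u) ⟩
    m ^ u * (m * (m + suc u) + u)  ≡⟨ solve 3 (λ m u w → w :* (m :* (m :+ (con 1 :+ u)) :+ u) := (con 1 :+ m) :* (w :* (m :+ u))) ≡.refl m u (m ^ u) ⟩
    suc m * (m ^ u * (m + u))      ≤⟨ *-monoʳ-≤ (suc m) (bernoulli m u) ⟩
    suc m * (m * suc m ^ u)        ≡⟨ solve 2 (λ m w → (con 1 :+ m) :* (m :* w) := m :* ((con 1 :+ m) :* w)) ≡.refl m (suc m ^ u) ⟩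
    m * (suc m * suc m ^ u)        ∎

  ^-distribʳ-* : ∀ d m n → (m * n) ^ d ≡ m ^ d * n ^ d
  ^-distribʳ-* zero    m n = ≡.refl
  ^-distribʳ-* (suc d) m n = ≡.trans (≡.cong (m * n *_) (^-distribʳ-* d m n)) ([m*n]*[o*p]≡[m*o]*[n*p] m n (m ^ d) (n ^ d))

  bernoulli-power : ∀ d m u → m ^ (u * d) * u ^ d ≤ m ^ d * suc m ^ (u * d)
  bernoulli-power d m u = begin
    m ^ (u * d) * u ^ d        ≡⟨ ≡.cong (_* u ^ d) (^-*-assoc m u d) ⟨
    (m ^ u) ^ d * u ^ d        ≡⟨ ^-distribʳ-* d (m ^ u) u ⟨
    (m ^ u * u) ^ d            ≤⟨ ^-monoˡ-≤ d (≤-trans (*-monoʳ-≤ (m ^ u) (m≤n+m u m)) (bernoulli m u)) ⟩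
    (m * suc m ^ u) ^ d        ≡⟨ ^-distribʳ-* d m (suc m ^ u) ⟩
    m ^ d * (suc m ^ u) ^ d    ≡⟨ ≡.cong (m ^ d *_) (^-*-assoc (suc m) u d) ⟩
    m ^ d * suc m ^ (u * d)    ∎

  -- Bernoulli for the exponent `s / d`, raised to the d-th power, gives degree `d` in `s`; the
  -- remainder of the division only costs m ≤ m + 1.
  exponential-growth : ∀ d .{{_ : NonZero d}} m s → m ^ s * (s / d) ^ d ≤ m ^ d * suc m ^ s
  exponential-growth d m s = begin
    m ^ s * u ^ d                       ≡⟨ ≡.cong (λ t → m ^ t * u ^ d) (m≡m%n+[m/n]*n s d) ⟩
    m ^ (r + u * d) * u ^ d             ≡⟨ ≡.cong (_* u ^ d) (^-distribˡ-+-* m r (u * d)) ⟩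
    m ^ r * m ^ (u * d) * u ^ d         ≡⟨ *-assoc (m ^ r) _ _ ⟩
    m ^ r * (m ^ (u * d) * u ^ d)       ≤⟨ *-mono-≤ (^-monoˡ-≤ r (n≤1+n m)) (bernoulli-power d m u) ⟩
    suc m ^ r * (m ^ d * suc m ^ (u * d)) ≡⟨ solve 3 (λ a b c → a :* (b :* c) := b :* (a :* c)) ≡.refl (suc m ^ r) (m ^ d) _ ⟩
    m ^ d * (suc m ^ r * suc m ^ (u * d)) ≡⟨ ≡.cong (m ^ d *_) (^-distribˡ-+-* (suc m) r (u * d)) ⟨
    m ^ d * suc m ^ (r + u * d)         ≡⟨ ≡.cong (λ t → m ^ d * suc m ^ t) (m≡m%n+[m/n]*n s d) ⟨
    m ^ d * suc m ^ s                   ∎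
    where
    u = s / d
    r = s % d

  exponential-wins : ∀ d C m → ∃[ P ] (∀ s → P < s → C * suc s ^ d * m ^ s < suc m ^ s)
  -- The case of a single colour, where the left side vanishes once the exponent is positive.
  exponential-wins d C zero = 0 , λ { (suc s) _ → begin-strict
    C * suc (suc s) ^ d * 0   ≡⟨ *-zeroʳ (C * suc (suc s) ^ d) ⟩
    0                         <⟨ m^n>0 1 (suc s) ⟩
    1 ^ suc s                 ∎ }
  exponential-wins d C m@(suc _) = suc B * D , λ s lt → *-cancelʳ-< (m ^ D) _ _ (bound s (<⇒≤ lt))
    where
    -- One degree more than the polynomial has: the surplus factor `u` then exceeds the constant
    -- `B`, which collects `C`, the loss in `suc s ≤ 2 * D * u` and the factor `m ^ D`.
    D = suc d
    B = C * (2 * D) ^ d * m ^ D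
    bound : ∀ s → suc B * D ≤ s → C * suc s ^ d * m ^ s * m ^ D < suc m ^ s * m ^ D
    bound s le = begin-strict
      C * suc s ^ d * m ^ s * m ^ D              ≤⟨ *-monoˡ-≤ (m ^ D) (*-monoˡ-≤ (m ^ s) (*-monoʳ-≤ C (^-monoˡ-≤ d s≤))) ⟩
      C * (2 * D * u) ^ d * m ^ s * m ^ D        ≡⟨ ≡.cong (λ t → C * t * m ^ s * m ^ D) (^-distribʳ-* d (2 * D) u) ⟩
      C * ((2 * D) ^ d * u ^ d) * m ^ s * m ^ D  ≡⟨ solve 5 (λ a b c e f → a :* (b :* c) :* e :* f := e :* ((a :* b :* f) :* c)) ≡.refl C ((2 * D) ^ d) (u ^ d) (m ^ s) (m ^ D) ⟩
      m ^ s * (B * u ^ d)                        <⟨ *-monoʳ-< (m ^ s) {{m^n≢0 m s}} (*-monoˡ-< (u ^ d) {{m^n≢0 u d}} B<u) ⟩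
      m ^ s * (u * u ^ d)                        ≤⟨ exponential-growth D m s ⟩
      m ^ D * suc m ^ s                          ≡⟨ *-comm (m ^ D) _ ⟩
      suc m ^ s * m ^ D                          ∎
      where
      u = s / D
      B<u : B < u
      B<u = begin
        suc B           ≡⟨ m*n/n≡m (suc B) D ⟨
        suc B * D / D   ≤⟨ /-mono-≤ le (≤-refl {D}) ⟩
        u               ∎
      instance
        u≢0 : NonZero u
        u≢0 = >-nonZero (≤-<-trans z≤n B<u)
      s≤ : suc s ≤ 2 * D * u
      s≤ = begin
        suc s                       ≡⟨ ≡.cong suc (m≡m%n+[m/n]*n s D) ⟩
        suc (s % D) + u * D         ≤⟨ +-monoˡ-≤ (u * D) (m%n<n s D) ⟩
        D + u * D                   ≤⟨ +-monoˡ-≤ (u * D) (m≤n*m D u) ⟩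
        u * D + u * D               ≡⟨ solve 2 (λ u D → u :* D :+ u :* D := con 2 :* D :* u) ≡.refl u D ⟩
        2 * D * u                   ∎

-- From edge labellings by atoms to representations.

module Cycles (p n : ℕ) where
  open import Data.Bool.Base using (T)
  open Lyndon p n using (Atom; e; a; t; ⟦_⟧; _∙_)

  -- The composition table as an inductive family, so that later arguments match on its cases
  -- instead of computing Booleans.
  data Cycle : Atom → Atom → Atom → Set where
    e∙ : ∀ {v} → Cycle e v v
    ∙e : ∀ {u} → Cycle u e u
    aae : ∀ {i} → Cycle (a i) (a i) e
    aaa : ∀ {i} → Cycle (a i) (a i) (a i)
    abc : ∀ {i j m} → i ≢ j → i ≢ m → j ≢ m → Cycle (a i) (a j) (a m)
    att : ∀ {i k l} → Cycle (a i) (t k) (t l)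
    tat : ∀ {i k l} → Cycle (t k) (a i) (t l)
    tte : ∀ {k} → Cycle (t k) (t k) e
    tta : ∀ {i k l} → Cycle (t k) (t l) (a i)

  below-atom : ∀ u {w} → T (⟦ u ⟧ w) → u ≡ w
  below-atom e     {e}   _ = ≡.refl
  below-atom (a i) {a j} h with i Fin.≟ j
  ... | yes ≡.refl = ≡.refl
  below-atom (t k) {t l} h with k Fin.≟ l
  ... | yes ≡.refl = ≡.refl

  atom-below : ∀ u → T (⟦ u ⟧ u)
  atom-below e = _
  atom-below (a i) with i Fin.≟ i
  ... | yes _ = _
  ... | no ne = contradiction ≡.refl ne
  atom-below (t k) with k Fin.≟ k
  ... | yes _ = _
  ... | no ne = contradiction ≡.refl ne

  toCycle : ∀ u v w → T ((u ∙ v) w) → Cycle u v w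
  toCycle e     v     w h with ≡.refl ← below-atom v {w} h = e∙
  toCycle (a i) e     w h with ≡.refl ← below-atom (a i) {w} h = ∙e
  toCycle (t k) e     w h with ≡.refl ← below-atom (t k) {w} h = ∙e
  toCycle (a i) (a j) w h with i Fin.≟ j
  toCycle (a i) (a j) e     h | yes ≡.refl = aae
  toCycle (a i) (a j) (a m) h | yes ≡.refl with ≡.refl ← below-atom (a i) {a m} h = aaa
  toCycle (a i) (a j) (a m) h | no i≢j with i Fin.≟ m | j Fin.≟ m
  ... | no i≢m | no j≢m = abc i≢j i≢m j≢m
  toCycle (a i) (t k) (t l) h = att
  toCycle (t k) (a i) (t l) h = tat
  toCycle (t k) (t l) w     h with k Fin.≟ l
  toCycle (t k) (t l) e     h | yes ≡.refl = tte
  toCycle (t k) (t l) (a i) h | yes ≡.refl = tta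
  toCycle (t k) (t l) (a i) h | no _ = tta

  fromCycle : ∀ {u v w} → Cycle u v w → T ((u ∙ v) w)
  fromCycle {v = v} e∙ = atom-below v
  fromCycle {e}   ∙e = _
  fromCycle {a i} ∙e = atom-below (a i)
  fromCycle {t k} ∙e = atom-below (t k)
  fromCycle {a i} aae with i Fin.≟ i
  ... | yes _ = _
  ... | no ne = contradiction ≡.refl ne
  fromCycle {a i} aaa with i Fin.≟ i
  ... | yes _ = atom-below (a i)
  ... | no ne = contradiction ≡.refl ne
  fromCycle {a i} {a j} {a m} (abc i≢j i≢m j≢m) with i Fin.≟ j
  ... | yes eq = contradiction eq i≢j
  ... | no _ with i Fin.≟ m | j Fin.≟ m
  ...   | yes eq | _      = contradiction eq i≢m
  ...   | no _   | yes eq = contradiction eq j≢m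
  ...   | no _   | no _   = _
  fromCycle att = _
  fromCycle tat = _
  fromCycle {t k} tte with k Fin.≟ k
  ... | yes _ = _
  ... | no ne = contradiction ≡.refl ne
  fromCycle {t k} {t l} tta with k Fin.≟ l
  ... | yes _ = _
  ... | no  _ = _

module Labellings {p n : ℕ} {D : Set} (lab : D → D → Lyndon.Atom p n) where
  open import Data.Bool.Base using (T; _∧_)
  open Lyndon p n
  open Cycles p n
  open import Data.Bool.ListAction using (any)
  open import Data.Bool.Properties using (T-∧; T-∨; T-≡; ⇔→≡)
  open import Data.List.Membership.Propositional using (_∈_)
  open import Data.List.Membership.Propositional.Properties using (∈-map⁺; ∈-++⁺ˡ; ∈-++⁺ʳ; ∈-allFin)
  open import Data.List.Relation.Unary.Any as Any using (here; there)
  import Data.List.Relation.Unary.Any.Properties as Any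
  import Data.List.Membership.Propositional as Membership
  open import Function.Bundles using (mk⇔)
  open import Level using (lift)
  open Equivalence

  ∈-atoms : ∀ u → u ∈ atoms
  ∈-atoms e     = here ≡.refl
  ∈-atoms (a i) = there (∈-++⁺ˡ (∈-map⁺ a (∈-allFin i)))
  ∈-atoms (t k) = there (∈-++⁺ʳ (List.map a (List.allFin (suc p))) (∈-map⁺ t (∈-allFin k)))

  any-atom⁻ : ∀ f → T (any f atoms) → ∃[ u ] T (f u)
  any-atom⁻ f h with Membership.find (Any.any⁻ f atoms h)
  ... | u , _ , fu = u , fu

  any-atom⁺ : ∀ f u → T (f u) → T (any f atoms)
  any-atom⁺ f u fu = Any.any⁺ f (Any.map (λ { ≡.refl → fu }) (∈-atoms u))

  -- `sound` and `complete` are the two inclusions in the law for composition; `onto` makes the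
  -- representation injective.
  record IsLabelling : Set where
    field
      lab-refl : ∀ d → lab d d ≡ e
      lab-e    : ∀ {d d′} → lab d d′ ≡ e → d ≡ d′
      lab-sym  : ∀ d d′ → lab d d′ ≡ lab d′ d
      sound    : ∀ d z d′ → Cycle (lab d z) (lab z d′) (lab d d′)
      complete : ∀ {u v} d d′ → Cycle u v (lab d d′) → ∃[ z ] (lab d z ≡ u × lab z d′ ≡ v)
      onto     : ∀ u → ∃₂ λ d d′ → lab d d′ ≡ u

  T-not : ∀ b → (T (not b) → ¬ T b) × (¬ T b → T (not b))
  T-not true  = (λ ()) , λ h → h _
  T-not false = (λ _ ()) , _

  representation : IsLabelling → Representation (𝔏 p n) D
  representation L = record
    { h         = λ x d d′ → T (x (lab d d′))
    ; cong      = λ eq → ≡.subst T (eq _) , ≡.subst T (≡.sym (eq _))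
    ; injective = λ { {x} {y} (f , g) → inj {x} {y} f g }
    ; h-𝟘       = (λ ()) , λ { (lift ()) }
    ; h-𝟙       = _ , _
    ; h-∁       = λ x → (λ {d} {d′} → proj₁ (T-not (x (lab d d′)))) , λ {d} {d′} → proj₂ (T-not (x (lab d d′)))
    ; h-+       = λ x y → to T-∨ , from T-∨
    ; h-·       = λ x y → to T-∧ , from T-∧
    ; h-1′      = (λ h → lab-e (≡.sym (below-atom e h))) , λ { {d} ≡.refl → ≡.subst (T ∘ ⟦ e ⟧) (≡.sym (lab-refl d)) _ }
    ; h-conv    = λ x → (λ {d} {d′} → ≡.subst (T ∘ x) (lab-sym d d′)) , λ {d} {d′} → ≡.subst (T ∘ x) (lab-sym d′ d)
    ; h-⊙       = λ x y → split x y , join x y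
    }
    where
    open IsLabelling L
    inj : ∀ {x y : Element} → (∀ {d d′} → T (x (lab d d′)) → T (y (lab d d′))) →
          (∀ {d d′} → T (y (lab d d′)) → T (x (lab d d′))) → x ≗ y
    inj f g u with d , d′ , ≡.refl ← onto u = ⇔→≡ (mk⇔ (to T-≡ ∘ f {d} {d′} ∘ from T-≡) (to T-≡ ∘ g {d} {d′} ∘ from T-≡))
    below : Element → Element → Atom → Atom → Atom → Bool
    below x y w u v = x u ∧ y v ∧ (u ∙ v) w
    split : ∀ x y {d d′} → T ((x ⊙ y) (lab d d′)) → ∃[ z ] (T (x (lab d z)) × T (y (lab z d′)))
    split x y {d} {d′} h
      with u , h₁ ← any-atom⁻ (λ u → any (below x y (lab d d′) u) atoms) h
      with v , h₂ ← any-atom⁻ (below x y (lab d d′) u) h₁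
      with xu , h₃ ← to (T-∧ {x u}) h₂
      with yv , h₄ ← to (T-∧ {y v}) h₃
      with z , ≡.refl , ≡.refl ← complete d d′ (toCycle u v _ h₄) = z , xu , yv
    join : ∀ x y {d d′} → ∃[ z ] (T (x (lab d z)) × T (y (lab z d′))) → T ((x ⊙ y) (lab d d′))
    join x y {d} {d′} (z , xu , yv) =
      any-atom⁺ (λ u → any (below x y (lab d d′) u) atoms) (lab d z) (any-atom⁺ (below x y (lab d d′) (lab d z)) (lab z d′)
      (from T-∧ (xu , from T-∧ (yv , fromCycle (sound d z d′)))))

-- The labelling of two copies of an affine plane.

module PlaneLabelling {r n : ℕ} (A : AffinePlane (3 ℕ.+ r))
  (col : Bool → Point (3 ℕ.+ r) → Point (3 ℕ.+ r) → Fin n)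
  (col-flip : ∀ x y → col true y x ≡ col false x y) (rich : Rich A col) where
  open AffinePlane A
  open PunctureLines A
  q : ℕ
  q = 3 ℕ.+ r
  open Lyndon q n using (Atom; e; a; t)
  open Cycles q n

  open import Data.Bool.Properties using () renaming (_≟_ to _≟ᵇ_)
  open ≡ using (refl; sym; trans; cong; subst)

  Pt : Set
  Pt = Point q



  col-sym : ∀ {s s′} → s ≢ s′ → ∀ x y → col s x y ≡ col s′ y x
  col-sym {false} {false} ne x y = contradiction refl ne
  col-sym {false} {true}  ne x y = sym (col-flip x y)
  col-sym {true}  {false} ne x y = col-flip y x
  col-sym {true}  {true}  ne x y = contradiction refl ne

  pigeonhole : ∀ {s s′ s″ : Bool} → s ≢ s′ → s′ ≢ s″ → s ≡ s″
  pigeonhole {false} {false} u v = contradiction refl u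
  pigeonhole {true}  {true}  u v = contradiction refl u
  pigeonhole {s′ = false} {false} u v = contradiction refl v
  pigeonhole {s′ = true}  {true}  u v = contradiction refl v
  pigeonhole {false} {true}  {false} u v = refl
  pigeonhole {true}  {false} {true}  u v = refl

  not≢ : ∀ s → not s ≢ s
  not≢ false ()
  not≢ true  ()

  -- Richness speaks of two distinct points; where only one colour is prescribed, this supplies the
  -- second.
  another : ∀ x → ∃[ y ] (x ≢ y)
  another x = others Fin.zero x Fin.zero , others≢ Fin.zero x Fin.zero ∘ sym

  -- As the order is at least 3, the line has at least two points besides `x`, and one of them is
  -- not `y`.
  third : ∀ i x y → ∃[ z ] (z ≢ x × z ≢ y × x ∥[ i ] z)
  third i x y with others i x Fin.zero ≟ₚ y
  ... | no ne    = _ , others≢ i x _ , ne , line-∥ i x _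
  ... | yes refl = others i x (Fin.suc Fin.zero) , others≢ i x _ , (λ eq → case (others-injective i x eq)) , line-∥ i x _
    where
    case : ¬ Fin.suc Fin.zero ≡ Fin.zero {suc r}
    case ()

  D : Set
  D = Bool × Pt

  data Label : D → D → Atom → Set where
    same  : ∀ {d} → Label d d e
    par   : ∀ {s x y i} → x ≢ y → x ∥[ i ] y → Label (s , x) (s , y) (a i)
    cross : ∀ {s s′ x y k} → s ≢ s′ → col s x y ≡ k → Label (s , x) (s′ , y) (t k)

  label : ∀ d d′ → ∃ (Label d d′)
  label (s , x) (s′ , y) with s ≟ᵇ s′
  ... | no s≢s′ = _ , cross s≢s′ refl
  ... | yes refl with x ≟ₚ y
  ...   | yes refl = _ , same
  ...   | no  x≢y  = _ , par x≢y (proj₂ (direction x≢y))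

  label-unique : ∀ {d d′ u v} → Label d d′ u → Label d d′ v → u ≡ v
  label-unique same        same         = refl
  label-unique same        (par ne _)   = contradiction refl ne
  label-unique same        (cross ne _) = contradiction refl ne
  label-unique (par ne _)  same         = contradiction refl ne
  label-unique (par ne h)  (par _ h′)   = cong a (unique ne h h′)
  label-unique (par _ _)   (cross ne _) = contradiction refl ne
  label-unique (cross ne _) same        = contradiction refl ne
  label-unique (cross ne _) (par _ _)   = contradiction refl ne
  label-unique (cross _ refl) (cross _ refl) = refl

  label-sym : ∀ {d d′ u} → Label d d′ u → Label d′ d u
  label-sym same         = same
  label-sym (par ne h)   = par (ne ∘ sym) (∥-sym h)
  label-sym (cross ne h) = cross (ne ∘ sym) (trans (sym (col-sym ne _ _)) h)

  label-sound : ∀ {d z d′ u v w} → Label d z u → Label z d′ v → Label d d′ w → Cycle u v w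
  label-sound same         g            h          with refl ← label-unique g h = e∙
  label-sound f            same         h          with refl ← label-unique f h = ∙e
  label-sound (par x≢z f)  (par _ g)    same       with refl ← unique x≢z f (∥-sym g) = aae
  label-sound (par {i = i} x≢z f) (par {i = j} z≢y g) (par x≢y h) with i Fin.≟ j
  ... | yes refl with refl ← unique x≢y (∥-trans f g) h = aaa
  -- If the third side repeated one of the two directions, transitivity would give the remaining
  -- side that direction too, forcing i = j.
  ... | no i≢j   = abc i≢j (λ { refl → i≢j (unique z≢y (∥-trans (∥-sym f) h) g) })
                           (λ { refl → i≢j (unique x≢z f (∥-trans h (∥-sym g))) })
  label-sound (par _ _)    (par _ _)    (cross ne _) = contradiction refl ne
  label-sound (par _ _)    (cross ne _) same         = contradiction refl ne
  label-sound (par _ _)    (cross ne _) (par _ _)    = contradiction refl ne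
  label-sound (par _ _)    (cross _ _)  (cross _ _)  = att
  label-sound (cross ne _) (par _ _)    same         = contradiction refl ne
  label-sound (cross ne _) (par _ _)    (par _ _)    = contradiction refl ne
  label-sound (cross _ _)  (par _ _)    (cross _ _)  = tat
  label-sound (cross ne f) (cross _ g)  same with refl ← trans (sym f) (trans (col-sym ne _ _) g) = tte
  label-sound (cross _ _)  (cross _ _)  (par _ _)    = tta
  -- The pairs across the copies form a bipartite graph, which has no triangle.
  label-sound (cross ne _) (cross ne′ _) (cross ne″ _) = contradiction (pigeonhole ne ne′) ne″

  label-complete : ∀ {d d′ u v w} → Cycle u v w → Label d d′ w → ∃[ z ] (Label d z u × Label z d′ v)
  label-complete e∙ h = _ , same , h
  label-complete ∙e h = _ , h , same
  label-complete {s , x} (aae {i}) same with z , z≢x , _ , h ← third i x x =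
    (s , z) , par (z≢x ∘ sym) h , par z≢x (∥-sym h)
  label-complete {s , x} {_ , y} (aaa {i}) (par x≢y h) with z , z≢x , z≢y , g ← third i x y =
    (s , z) , par (z≢x ∘ sym) g , par z≢y (∥-trans (∥-sym g) h)
  -- The intersection of the two lines is neither `x` nor `y`, since otherwise the direction m of xy
  -- would be j or i.
  label-complete {s , x} {_ , y} (abc i≢j i≢m j≢m) (par x≢y h) with z , f , g ← meet i≢j x y =
    (s , z) , par (λ { refl → j≢m (unique x≢y g h) }) f , par (λ { refl → i≢m (unique x≢y f h) }) g
  label-complete {s , x} {s′ , y} (att {i} {k}) (cross ne h)
    with z , z≢x , g , eq , _ ← rich s i x (proj₂ (another y)) k k = (s , z) , par (z≢x ∘ sym) g , cross ne eq
  label-complete {s , x} {s′ , y} (tat {i} {k}) (cross ne h)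
    with z , z≢y , g , eq , _ ← rich s′ i y (proj₂ (another x)) k k =
    (s′ , z) , cross ne (trans (col-sym ne x z) eq) , par z≢y (∥-sym g)
  label-complete {s , x} (tte {k}) same
    with z , _ , _ , eq , _ ← rich (not s) Fin.zero x (proj₂ (another x)) k k =
    (not s , z) , label-sym (cross (not≢ s) eq) , cross (not≢ s) eq
  label-complete {s , x} {_ , y} (tta {k = k} {l}) (par x≢y h)
    -- Any line of the other copy serves here; the vertical one through the point with the
    -- coordinates of `x` is taken.
    with z , _ , _ , eq , eq′ ← rich (not s) Fin.zero x x≢y k l =
    (not s , z) , label-sym (cross (not≢ s) eq) , cross (not≢ s) eq′

  lab : D → D → Atom
  lab d d′ = proj₁ (label d d′)

  lab≡ : ∀ {d d′ u} → Label d d′ u → lab d d′ ≡ u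
  lab≡ h = label-unique (proj₂ (label _ _)) h

  label-e : ∀ {d d′} → Label d d′ e → d ≡ d′
  label-e same = refl

  origin : Pt
  origin = Fin.zero , Fin.zero

  label-onto : ∀ u → ∃₂ λ d d′ → Label d d′ u
  label-onto e     = (false , origin) , _ , same
  label-onto (a i) with z , z≢ , _ , h ← third i origin origin = (false , origin) , _ , par (z≢ ∘ sym) h
  label-onto (t k) with z , _ , _ , eq , _ ← rich false Fin.zero origin (proj₂ (another origin)) k k =
    (false , z) , (true , origin) , cross (λ ()) eq

  open Labellings lab using (IsLabelling; representation)

  isLabelling : IsLabelling
  isLabelling = record
    { lab-refl = λ d → lab≡ (same {d})
    ; lab-e    = λ {d} {d′} eq → label-e (subst (Label d d′) eq (proj₂ (label d d′)))
    ; lab-sym  = λ d d′ → lab≡ (label-sym (proj₂ (label d′ d)))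
    ; sound    = λ d z d′ → label-sound (proj₂ (label d z)) (proj₂ (label z d′)) (proj₂ (label d d′))
    ; complete = λ d d′ c → let z , f , g = label-complete c (proj₂ (label d d′)) in z , lab≡ f , lab≡ g
    ; onto     = λ u → let d , d′ , h = label-onto u in d , d′ , lab≡ h
    }

  plane-representation : Representation (𝔏 q n) D
  plane-representation = representation isLabelling

-- Counting the tests and putting the pieces together.

module Assembly where
  open import Data.Nat.Base
  open import Data.Nat.Properties
  open import Data.Nat.Solver using (module +-*-Solver)
  open import Data.Product.Function.NonDependent.Propositional using (_×-↔_)
  open import Function.Construct.Composition using (_↔-∘_)
  open import Function.Construct.Symmetry using (↔-sym)
  open ≡ using (refl; sym; subst)

  affinePlane : ∀ r → PrimePower (3 + r) → AffinePlane (3 + r)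
  affinePlane r (p , k , pr , 1≤k , eq) =
    Coordinates.affinePlane (subst FiniteField (sym eq)
      (Cardinality.finiteField pr k (suc r) (sym eq) (FieldConstruction.generatedField pr k (suc r) (sym eq) 1≤k)))

  points↔Fin : ∀ q → (Bool × Point q) ↔ Fin (2 * q ^ 2)
  points↔Fin q = subst (λ N → (Bool × Point q) ↔ Fin (2 * (q * N))) (sym (*-identityʳ q))
    (↔-sym Fin.*↔× ↔-∘ (↔-sym Fin.2↔Bool ×-↔ ↔-sym Fin.*↔×))

  -- With order `suc q`, the number of directions is rounded up to twice the order. The exponent 7
  -- counts six point coordinates and one direction; 4 is this rounding times the two copies.
  tests≤ : ∀ q n → let Q = λ B → suc q * (suc q * B) in
           Q (Q (Q (suc (suc q) * (n * (n * 2))))) ≤ 4 * n * n * suc q ^ 7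
  tests≤ q n = begin
    Q (Q (Q (suc (suc q) * (n * (n * 2)))))  ≤⟨ Q-mono (Q-mono (Q-mono (*-monoˡ-≤ (n * (n * 2)) (s≤s (s≤s (m≤n+m q q)))))) ⟩
    Q (Q (Q ((2 + (q + q)) * (n * (n * 2)))))
      ≡⟨ solve 2 (λ q n → let x = con 1 :+ q ; R = λ B → x :* (x :* B) in
           R (R (R ((con 2 :+ (q :+ q)) :* (n :* (n :* con 2))))) := con 4 :* n :* n :* (x :^ 7)) refl q n ⟩
    4 * n * n * suc q ^ 7                    ∎
    where
    open ≤-Reasoning
    open +-*-Solver using (solve; _:+_; _:*_; _:^_; _:=_; con)
    Q : ℕ → ℕ
    Q B = suc q * (suc q * B)
    Q-mono : ∀ {A B} → A ≤ B → Q A ≤ Q B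
    Q-mono le = *-monoʳ-≤ (suc q) (*-monoʳ-≤ (suc q) le)

  represent : ∀ {n m} r → .{{_ : NonZero n}} → n * n ≡ suc m → AffinePlane (3 + r) →
              4 * n * n * (3 + r) ^ 7 * m ^ (2 + r) < suc m ^ (2 + r) → RepresentableOverSize (𝔏 (3 + r) n) (2 * (3 + r) ^ 2)
  represent {n} {m} r n²≡ A lt =
    let col , flip , rich = RandomColouring.rich-colouring A n n²≡
          (≤-<-trans (*-monoˡ-≤ (m ^ (2 + r)) (tests≤ (2 + r) n)) lt)
    in (Bool × Point (3 + r)) , points↔Fin (3 + r) , PlaneLabelling.plane-representation A col flip rich

open Assembly using (affinePlane; represent)
open import Data.Nat.Base using (_*_; _^_)

theorem13 : ∀ (n : ℕ) → 1 ≤ n →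
    ∃[ P ] (∀ (p : ℕ) → 3 ≤ p → PrimePower p → P < p →
    RepresentableOverSize (𝔏 p n) (2 * p ^ 2))
-- The exponent in the growth estimate is p - 1, the number of points on a punctured line, so the
-- threshold shifts by one.
theorem13 n@(suc n-1) 1≤n = suc P , λ { (suc (suc (suc r))) (s≤s (s≤s (s≤s _))) pp P<p →
    represent r ≡.refl (affinePlane r pp) (wins (2 ℕ.+ r) (ℕ.s≤s⁻¹ P<p)) }
  where
  -- The last argument is n² - 1, in the form for which `n * n` is its successor by computation.
  growth = Growth.exponential-wins 7 (4 * n * n) (n-1 ℕ.+ n-1 * n)
  P = proj₁ growth
  wins = proj₂ growth
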